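{- The LTL model-checking problem for hybrid Kripke structures is undecidable. Here the LTL model-checking problem is: given a hybrid Kripke structure $(\mathcal{H},P,L)$ and an LTL formula $\phi$ over $P$, decide whether $(\mathcal{H},P,L)\models\phi$, i.e. whether all traces of $(\mathcal{H},P,L)$ satisfy $\phi$ (and, if not, give a counterexample, i.e. a run violating $\phi$).
   Context: **Undecidability.** A problem is decidable if one can write a computer program that always terminates with a correct answer; it is undecidable if no such program exists. **Predicates.** For a finite set $X$ of real-valued variables, a valuation is a point $\nu\in\mathbb{R}^{|X|}$, and a predicate over $X$ is a subset of $\mathbb{R}^{|X|}$ (for computer-readable representation, predicates are often defined using non-linear algebraic equations involving $X$). The set of predicates over $X$ is $\mathrm{pred}(X)$, and $[\![\pi]\!]$ denotes the set of valuations satisfying $\pi$. $X'$ denotes a set of primed copies of the variables in $X$; a predicate over $X\cup X'$ is a set of pairs $(\nu,\nu')$. **Hybrid automaton.** A hybrid automaton is a tuple $\mathcal{H}=(M,M_0,\Sigma,X,\Delta,I,F,V_0)$ where - $M$ is a finite set of modes and $M_0\subseteq M$ is the set of initial modes; - $\Sigma$ is a finite set of actions; - $X$ is a finite set of real-valued variables; - $\Delta\subseteq M\times\mathrm{pred}(X)\times\Sigma\times\mathrm{pred}(X\cup X')\times M$ is the transition relation, whose elements are written $(m,g,a,j,m')$ with guard $g$ and jump predicate $j$; - $I:M\to\mathrm{pred}(X)$ gives the mode invariants; - $F:M\to(\mathbb{R}^{|X|}\to\mathbb{R}^{|X|})$ gives for each mode $m$ a Lipschitz-continuous flow function $F(m)$,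 defining the system of ODEs $\dot X=F(m)(X)$; - $V_0\in\mathrm{pred}(X)$ is the set of initial valuations. For $t\in\mathbb{R}_{\ge0}$, $\nu\oplus_{F(m)}t$ denotes the value at time $t$ of the unique solution of $\dot X=F(m)(X)$ with initial value $\nu$. **Semantics.** The configurations of $\mathcal{H}$ are the pairs $(m,\nu)\in M\times\mathbb{R}^{|X|}$ with $\nu\in[\![I(m)]\!]$. A configuration is initial if $m\in M_0$ and $\nu\in V_0$. There is a transition from $(m,\nu)$ to $(m',\nu')$ labelled $(t,a)\in\mathbb{R}_{\ge0}\times\Sigma$ if there is $(m,g,a,j,m')\in\Delta$ such that $\nu\oplus_{F(m)}t\in[\![g]\!]$; $\nu\oplus_{F(m)}\tau\in[\![I(m)]\!]$ for all $\tau\in[0,t]$; $(\nu\oplus_{F(m)}t,\nu')\in[\![j]\!]$; and $\nu'\in[\![I(m')]\!]$. An infinite run is an infinite sequence $\langle(m_0,\nu_0),(t_1,a_1),(m_1,\nu_1),(t_2,a_2),\ldots\rangle$ starting in an initial configuration and such that consecutive configurations are connected by transitions with the indicated labels. **Hybrid Kripke structure.** A hybrid Kripke structure is a tuple $(\mathcal{H},P,L)$ with $\mathcal{H}$ a hybrid automaton, $P$ a finite set of atomic propositions, and $L:M\to2^P$ a labeling function. The trace of an infinite run is $\langle L(m_0),L(m_1),L(m_2),\ldots\rangle$. $\mathrm{Trace}(\mathcal{H},P,L)$ is the set of traces of $(\mathcal{H},P,L)$. **LTL.** Formulas over $P$ are generated from $\top$, $\bot$ and $p\in P$ by $\neg\phi$,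 $\phi\wedge\psi$, $\phi\vee\psi$, $\bigcirc\phi$, $\Diamond\phi$, $\Box\phi$, $\phi\,\mathcal{U}\,\psi$. For a trace $\sigma=\langle P_0,P_1,\ldots\rangle$ with suffixes $\sigma[i]=\langle P_i,P_{i+1},\ldots\rangle$: $\sigma\models\top$; $\sigma\not\models\bot$; $\sigma\models p$ iff $p\in P_0$; Boolean connectives are as usual; $\sigma\models\bigcirc\phi$ iff $\sigma[1]\models\phi$; $\sigma\models\Diamond\phi$ iff $\sigma[i]\models\phi$ for some $i\ge0$; $\sigma\models\Box\phi$ iff $\sigma[i]\models\phi$ for all $i\ge0$; $\sigma\models\phi\,\mathcal{U}\,\psi$ iff there is $i\ge0$ with $\sigma[i]\models\psi$ and $\sigma[j]\models\phi$ for all $0\le j<i$. Finally $(\mathcal{H},P,L)\models\phi$ iff $\sigma\models\phi$ for every $\sigma\in\mathrm{Trace}(\mathcal{H},P,L)$. -}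

module Defs where

open import Data.Bool.Base using (Bool; true; false)
open import Data.Empty using (⊥)
open import Data.Fin.Base using (Fin; toℕ)
open import Data.Fin.Subset using (Subset; _∈_)
open import Data.Integer.Base using (ℤ; +_; -[1+_])
open import Data.List.Base as List using (List; []; _∷_)
import Data.List.Membership.Propositional as List
open import Data.Nat.Base as ℕ using (ℕ; zero; suc)
import Data.Nat.Properties as ℕ
open import Data.Product.Base using (∃-syntax; _×_; _,_)
open import Data.Rational.Base as ℚ using (ℚ; 0ℚ; 1ℚ; ½)
import Data.Rational.Properties as ℚ
open import Data.Rational.Solver using (module +-*-Solver)
open import Data.Sum.Base as Sum using (_⊎_; inj₁; inj₂)
open import Data.Unit.Base using (⊤)
open import Data.Vec.Base as Vec using (Vec)
import Data.Vec.Functional as Fun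
open import Function.Base using (_∘_)
open import Level using (Level; 0ℓ) renaming (suc to lsuc; _⊔_ to _⊔ˡ_)
open import Relation.Binary.PropositionalEquality using (_≡_; refl; sym; trans; cong; cong₂; subst)
open import Relation.Nullary.Negation.Core using (¬_)

Cauchy : (ℕ → ℚ) → Set
Cauchy f = ∀ ε → 0ℚ ℚ.< ε →
  ∃[ N ] (∀ m n → N ℕ.≤ m → N ℕ.≤ n → ℚ.∣ f m ℚ.- f n ∣ ℚ.≤ ε)

record ℝ : Set where
  constructor mkℝ
  field
    seq    : ℕ → ℚ
    cauchy : Cauchy seq

open ℝ public

infix 4 _≈ᵣ_ _<ᵣ_ _≤ᵣ_

_≈ᵣ_ : ℝ → ℝ → Set
x ≈ᵣ y = ∀ ε → 0ℚ ℚ.< ε →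
  ∃[ N ] (∀ n → N ℕ.≤ n → ℚ.∣ seq x n ℚ.- seq y n ∣ ℚ.≤ ε)

_<ᵣ_ : ℝ → ℝ → Set
x <ᵣ y = ∃[ ε ] 0ℚ ℚ.< ε ×
  (∃[ N ] (∀ n → N ℕ.≤ n → seq x n ℚ.+ ε ℚ.≤ seq y n))

_≤ᵣ_ : ℝ → ℝ → Set
x ≤ᵣ y = ¬ (y <ᵣ x)

private
  open +-*-Solver using (solve; _:=_; _:+_; _:*_; _:-_; :-_)

  half-pos : ∀ {ε} → 0ℚ ℚ.< ε → 0ℚ ℚ.< ½ ℚ.* ε
  half-pos {ε} 0<ε = subst (ℚ._< ½ ℚ.* ε) (ℚ.*-zeroʳ ½) (ℚ.*-monoʳ-<-pos ½ 0<ε)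

  halves : ∀ ε → ½ ℚ.* ε ℚ.+ ½ ℚ.* ε ≡ ε
  halves ε = trans (sym (ℚ.*-distribʳ-+ ε ½ ½)) (ℚ.*-identityˡ ε)

  dist : ℚ → ℚ → ℚ
  dist p q = ℚ.∣ p ℚ.- q ∣

  dist-sym : ∀ p q → dist p q ≡ dist q p
  dist-sym p q = trans (sym (ℚ.∣-p∣≡∣p∣ (p ℚ.- q)))
    (cong ℚ.∣_∣ (solve 2 (λ p q → :- (p :- q) := q :- p) refl p q))

  dist-tri : ∀ p q r → dist p r ℚ.≤ dist p q ℚ.+ dist q r
  dist-tri p q r = subst (λ z → ℚ.∣ z ∣ ℚ.≤ dist p q ℚ.+ dist q r)
    (solve 3 (λ p q r → (p :- q) :+ (q :- r) := p :- r) refl p q r)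
    (ℚ.∣p+q∣≤∣p∣+∣q∣ (p ℚ.- q) (q ℚ.- r))

  dist-refl : ∀ p → dist p p ≡ 0ℚ
  dist-refl p = cong ℚ.∣_∣ (ℚ.+-inverseʳ p)

  dist-+ : ∀ p q r s → dist (p ℚ.+ q) (r ℚ.+ s) ℚ.≤ dist p r ℚ.+ dist q s
  dist-+ p q r s = subst (λ z → ℚ.∣ z ∣ ℚ.≤ dist p r ℚ.+ dist q s)
    (solve 4 (λ p q r s → (p :- r) :+ (q :- s) := (p :+ q) :- (r :+ s)) refl p q r s)
    (ℚ.∣p+q∣≤∣p∣+∣q∣ (p ℚ.- r) (q ℚ.- s))

  dist-neg : ∀ p q → dist (ℚ.- p) (ℚ.- q) ≡ dist p q
  dist-neg p q = trans
    (cong ℚ.∣_∣ (solve 2 (λ p q → :- p :- :- q := :- (p :- q)) refl p q))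
    (ℚ.∣-p∣≡∣p∣ (p ℚ.- q))

  abs≤ : ∀ p q → ℚ.∣ p ∣ ℚ.≤ dist p q ℚ.+ ℚ.∣ q ∣
  abs≤ p q = subst (λ z → ℚ.∣ z ∣ ℚ.≤ dist p q ℚ.+ ℚ.∣ q ∣)
    (solve 2 (λ p q → (p :- q) :+ q := p) refl p q)
    (ℚ.∣p+q∣≤∣p∣+∣q∣ (p ℚ.- q) q)

  sub≤ : ∀ {p q r} → p ℚ.≤ q ℚ.+ r → p ℚ.- r ℚ.≤ q
  sub≤ {p} {q} {r} h = subst (p ℚ.- r ℚ.≤_)
    (solve 2 (λ q r → (q :+ r) :- r := q) refl q r)
    (ℚ.+-monoˡ-≤ (ℚ.- r) h)

  dist-abs : ∀ p q → dist ℚ.∣ p ∣ ℚ.∣ q ∣ ℚ.≤ dist p q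
  dist-abs p q with ℚ.∣p∣≡p∨∣p∣≡-p (ℚ.∣ p ∣ ℚ.- ℚ.∣ q ∣)
  ... | inj₁ e = subst (ℚ._≤ dist p q) (sym e) (sub≤ (abs≤ p q))
  ... | inj₂ e = subst (ℚ._≤ dist p q)
    (sym (trans e (solve 2 (λ a b → :- (a :- b) := b :- a) refl ℚ.∣ p ∣ ℚ.∣ q ∣)))
    (sub≤ (subst (λ z → ℚ.∣ q ∣ ℚ.≤ z ℚ.+ ℚ.∣ p ∣) (dist-sym q p) (abs≤ q p)))

  dist-* : ∀ p q r s →
    dist (p ℚ.* q) (r ℚ.* s) ℚ.≤ ℚ.∣ p ∣ ℚ.* dist q s ℚ.+ ℚ.∣ s ∣ ℚ.* dist p r
  dist-* p q r s = subst (λ z → ℚ.∣ z ∣ ℚ.≤ ℚ.∣ p ∣ ℚ.* dist q s ℚ.+ ℚ.∣ s ∣ ℚ.* dist p r)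
    (solve 4 (λ p q r s → (p :* (q :- s)) :+ (s :* (p :- r)) := (p :* q) :- (r :* s)) refl p q r s)
    (subst (ℚ.∣ p ℚ.* (q ℚ.- s) ℚ.+ s ℚ.* (p ℚ.- r) ∣ ℚ.≤_)
      (cong₂ ℚ._+_ (ℚ.∣p*q∣≡∣p∣*∣q∣ p (q ℚ.- s)) (ℚ.∣p*q∣≡∣p∣*∣q∣ s (p ℚ.- r)))
      (ℚ.∣p+q∣≤∣p∣+∣q∣ (p ℚ.* (q ℚ.- s)) (s ℚ.* (p ℚ.- r))))

  add-halves : ∀ {p q ε} → p ℚ.≤ ½ ℚ.* ε → q ℚ.≤ ½ ℚ.* ε → p ℚ.+ q ℚ.≤ ε
  add-halves {p} {q} {ε} h k = subst (p ℚ.+ q ℚ.≤_) (halves ε) (ℚ.+-mono-≤ h k)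

  shrink : ∀ B ε → 0ℚ ℚ.< B → 0ℚ ℚ.< ε → ∃[ δ ] 0ℚ ℚ.< δ × B ℚ.* δ ≡ ε
  shrink B ε 0<B 0<ε = ℚ.1/_ B ℚ.* ε , 0<δ , eq
    where
    instance
      posB : ℚ.Positive B
      posB = ℚ.positive 0<B
      nzB : ℚ.NonZero B
      nzB = ℚ.pos⇒nonZero B
      posB⁻¹ : ℚ.Positive (ℚ.1/ B)
      posB⁻¹ = ℚ.1/pos⇒pos B
    0<δ : 0ℚ ℚ.< ℚ.1/_ B ℚ.* ε
    0<δ = subst (ℚ._< ℚ.1/_ B ℚ.* ε) (ℚ.*-zeroʳ (ℚ.1/ B)) (ℚ.*-monoʳ-<-pos (ℚ.1/ B) 0<ε)
    eq : B ℚ.* (ℚ.1/_ B ℚ.* ε) ≡ ε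
    eq = trans (sym (ℚ.*-assoc B (ℚ.1/ B) ε))
      (trans (cong (ℚ._* ε) (ℚ.*-inverseʳ B)) (ℚ.*-identityˡ ε))

  mul≤ : ∀ {b B d δ} → 0ℚ ℚ.≤ d → 0ℚ ℚ.≤ B → b ℚ.≤ B → d ℚ.≤ δ → b ℚ.* d ℚ.≤ B ℚ.* δ
  mul≤ {b} {B} {d} {δ} 0≤d 0≤B b≤B d≤δ = ℚ.≤-trans
    (ℚ.*-monoʳ-≤-nonNeg d {{ℚ.nonNegative 0≤d}} b≤B)
    (ℚ.*-monoˡ-≤-nonNeg B {{ℚ.nonNegative 0≤B}} d≤δ)

  0<1 : 0ℚ ℚ.< 1ℚ
  0<1 = ℚ.positive⁻¹ 1ℚ

  bounded : ∀ x → ∃[ B ] 0ℚ ℚ.< B × (∃[ N ] (∀ n → N ℕ.≤ n → ℚ.∣ seq x n ∣ ℚ.≤ B))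
  bounded x with cauchy x 1ℚ 0<1
  ... | N , h = 1ℚ ℚ.+ ℚ.∣ seq x N ∣
              , ℚ.+-mono-<-≤ 0<1 (ℚ.0≤∣p∣ (seq x N))
              , N , λ n N≤n → ℚ.≤-trans (abs≤ (seq x n) (seq x N))
                                (ℚ.+-monoˡ-≤ ℚ.∣ seq x N ∣ (h n N N≤n ℕ.≤-refl))

  ⊔≤ˡ : ∀ {m n o} → m ℕ.⊔ n ℕ.≤ o → m ℕ.≤ o
  ⊔≤ˡ {m} {n} = ℕ.≤-trans (ℕ.m≤m⊔n m n)

  ⊔≤ʳ : ∀ {m n o} → m ℕ.⊔ n ℕ.≤ o → n ℕ.≤ o
  ⊔≤ʳ {m} {n} = ℕ.≤-trans (ℕ.m≤n⊔m m n)

abstract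
  const-cauchy : ∀ q → Cauchy (λ _ → q)
  const-cauchy q ε 0<ε = 0 , λ _ _ _ _ → subst (ℚ._≤ ε) (sym (dist-refl q)) (ℚ.<⇒≤ 0<ε)

fromℚ : ℚ → ℝ
fromℚ q = mkℝ (λ _ → q) (const-cauchy q)

0ᵣ : ℝ
0ᵣ = fromℚ 0ℚ

infixl 6 _+ᵣ_ _-ᵣ_
infixl 7 _*ᵣ_
infix  8 -ᵣ_

abstract
  +ᵣ-cauchy : ∀ x y → Cauchy (λ n → seq x n ℚ.+ seq y n)
  +ᵣ-cauchy x y ε 0<ε =
    let (N , h) = cauchy x (½ ℚ.* ε) (half-pos 0<ε)
        (M , k) = cauchy y (½ ℚ.* ε) (half-pos 0<ε)
    in N ℕ.⊔ M , λ m n p q → ℚ.≤-trans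
         (dist-+ (seq x m) (seq y m) (seq x n) (seq y n))
         (add-halves (h m n (⊔≤ˡ p) (⊔≤ˡ q)) (k m n (⊔≤ʳ {N} p) (⊔≤ʳ {N} q)))

_+ᵣ_ : ℝ → ℝ → ℝ
x +ᵣ y = mkℝ (λ n → seq x n ℚ.+ seq y n) (+ᵣ-cauchy x y)

abstract
  -ᵣ-cauchy : ∀ x → Cauchy (λ n → ℚ.- seq x n)
  -ᵣ-cauchy x ε 0<ε =
    let (N , h) = cauchy x ε 0<ε
    in N , λ m n p q → subst (ℚ._≤ ε) (sym (dist-neg (seq x m) (seq x n))) (h m n p q)

-ᵣ_ : ℝ → ℝ
-ᵣ x = mkℝ (λ n → ℚ.- seq x n) (-ᵣ-cauchy x)

_-ᵣ_ : ℝ → ℝ → ℝ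
x -ᵣ y = x +ᵣ (-ᵣ y)

abstract
  ∣∣ᵣ-cauchy : ∀ x → Cauchy (λ n → ℚ.∣ seq x n ∣)
  ∣∣ᵣ-cauchy x ε 0<ε =
    let (N , h) = cauchy x ε 0<ε
    in N , λ m n p q → ℚ.≤-trans (dist-abs (seq x m) (seq x n)) (h m n p q)

∣_∣ᵣ : ℝ → ℝ
∣ x ∣ᵣ = mkℝ (λ n → ℚ.∣ seq x n ∣) (∣∣ᵣ-cauchy x)

abstract
  *ᵣ-cauchy : ∀ x y → Cauchy (λ n → seq x n ℚ.* seq y n)
  *ᵣ-cauchy x y ε 0<ε =
    let (A , 0<A , N₁ , a) = bounded x
        (B , 0<B , N₂ , b) = bounded y
        (δ , 0<δ , Aδ) = shrink A (½ ℚ.* ε) 0<A (half-pos 0<ε)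
        (η , 0<η , Bη) = shrink B (½ ℚ.* ε) 0<B (half-pos 0<ε)
        (N₃ , k) = cauchy y δ 0<δ
        (N₄ , h) = cauchy x η 0<η
    in (N₁ ℕ.⊔ N₂) ℕ.⊔ (N₃ ℕ.⊔ N₄) , λ m n p q → ℚ.≤-trans
         (dist-* (seq x m) (seq y m) (seq x n) (seq y n))
         (add-halves
           (ℚ.≤-trans
             (mul≤ (ℚ.0≤∣p∣ (seq y m ℚ.- seq y n)) (ℚ.<⇒≤ 0<A)
               (a m (⊔≤ˡ (⊔≤ˡ p)))
               (k m n (⊔≤ˡ (⊔≤ʳ {N₁ ℕ.⊔ N₂} p)) (⊔≤ˡ (⊔≤ʳ {N₁ ℕ.⊔ N₂} q))))
             (ℚ.≤-reflexive Aδ))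
           (ℚ.≤-trans
             (mul≤ (ℚ.0≤∣p∣ (seq x m ℚ.- seq x n)) (ℚ.<⇒≤ 0<B)
               (b n (⊔≤ʳ {N₁} (⊔≤ˡ q)))
               (h m n (⊔≤ʳ {N₃} (⊔≤ʳ {N₁ ℕ.⊔ N₂} p)) (⊔≤ʳ {N₃} (⊔≤ʳ {N₁ ℕ.⊔ N₂} q))))
             (ℚ.≤-reflexive Bη)))

_*ᵣ_ : ℝ → ℝ → ℝ
x *ᵣ y = mkℝ (λ n → seq x n ℚ.* seq y n) (*ᵣ-cauchy x y)

≈ᵣ-refl : ∀ {x} → x ≈ᵣ x
≈ᵣ-refl {x} ε 0<ε = 0 , λ n _ → subst (ℚ._≤ ε) (sym (dist-refl (seq x n))) (ℚ.<⇒≤ 0<ε)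

≈ᵣ-sym : ∀ {x y} → x ≈ᵣ y → y ≈ᵣ x
≈ᵣ-sym {x} {y} x≈y ε 0<ε =
  let (N , h) = x≈y ε 0<ε
  in N , λ n p → subst (ℚ._≤ ε) (dist-sym (seq x n) (seq y n)) (h n p)

≈ᵣ-trans : ∀ {x y z} → x ≈ᵣ y → y ≈ᵣ z → x ≈ᵣ z
≈ᵣ-trans {x} {y} {z} x≈y y≈z ε 0<ε =
  let (N , h) = x≈y (½ ℚ.* ε) (half-pos 0<ε)
      (M , k) = y≈z (½ ℚ.* ε) (half-pos 0<ε)
  in N ℕ.⊔ M , λ n p → ℚ.≤-trans
       (dist-tri (seq x n) (seq y n) (seq z n))
       (add-halves (h n (⊔≤ˡ p)) (k n (⊔≤ʳ {N} p)))

+ᵣ-cong : ∀ {x x′ y y′} → x ≈ᵣ x′ → y ≈ᵣ y′ → x +ᵣ y ≈ᵣ x′ +ᵣ y′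
+ᵣ-cong {x} {x′} {y} {y′} x≈ y≈ ε 0<ε =
  let (N , h) = x≈ (½ ℚ.* ε) (half-pos 0<ε)
      (M , k) = y≈ (½ ℚ.* ε) (half-pos 0<ε)
  in N ℕ.⊔ M , λ n p → ℚ.≤-trans
       (dist-+ (seq x n) (seq y n) (seq x′ n) (seq y′ n))
       (add-halves (h n (⊔≤ˡ p)) (k n (⊔≤ʳ {N} p)))

-ᵣ-cong : ∀ {x x′} → x ≈ᵣ x′ → -ᵣ x ≈ᵣ -ᵣ x′
-ᵣ-cong {x} {x′} x≈ ε 0<ε =
  let (N , h) = x≈ ε 0<ε
  in N , λ n p → subst (ℚ._≤ ε) (sym (dist-neg (seq x n) (seq x′ n))) (h n p)

*ᵣ-cong : ∀ {x x′ y y′} → x ≈ᵣ x′ → y ≈ᵣ y′ → x *ᵣ y ≈ᵣ x′ *ᵣ y′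
*ᵣ-cong {x} {x′} {y} {y′} x≈ y≈ ε 0<ε =
  let (A , 0<A , N₁ , a) = bounded x
      (B , 0<B , N₂ , b) = bounded y′
      (δ , 0<δ , Aδ) = shrink A (½ ℚ.* ε) 0<A (half-pos 0<ε)
      (η , 0<η , Bη) = shrink B (½ ℚ.* ε) 0<B (half-pos 0<ε)
      (N₃ , k) = y≈ δ 0<δ
      (N₄ , h) = x≈ η 0<η
  in (N₁ ℕ.⊔ N₂) ℕ.⊔ (N₃ ℕ.⊔ N₄) , λ n p → ℚ.≤-trans
       (dist-* (seq x n) (seq y n) (seq x′ n) (seq y′ n))
       (add-halves
         (ℚ.≤-trans
           (mul≤ (ℚ.0≤∣p∣ (seq y n ℚ.- seq y′ n)) (ℚ.<⇒≤ 0<A)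
             (a n (⊔≤ˡ (⊔≤ˡ p))) (k n (⊔≤ˡ (⊔≤ʳ {N₁ ℕ.⊔ N₂} p))))
           (ℚ.≤-reflexive Aδ))
         (ℚ.≤-trans
           (mul≤ (ℚ.0≤∣p∣ (seq x n ℚ.- seq x′ n)) (ℚ.<⇒≤ 0<B)
             (b n (⊔≤ʳ {N₁} (⊔≤ˡ p))) (h n (⊔≤ʳ {N₃} (⊔≤ʳ {N₁ ℕ.⊔ N₂} p))))
           (ℚ.≤-reflexive Bη)))

private
  ≤-abs : ∀ p → p ℚ.≤ ℚ.∣ p ∣
  ≤-abs p with ℚ.≤-total p 0ℚ
  ... | inj₁ p≤0 = ℚ.≤-trans p≤0 (ℚ.0≤∣p∣ p)
  ... | inj₂ 0≤p = ℚ.≤-reflexive (sym (ℚ.0≤p⇒∣p∣≡p 0≤p))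

  ≤-dist : ∀ p q → p ℚ.≤ q ℚ.+ dist p q
  ≤-dist p q = subst (ℚ._≤ q ℚ.+ dist p q)
    (solve 2 (λ p q → q :+ (p :- q) := p) refl p q)
    (ℚ.+-monoʳ-≤ q (≤-abs (p ℚ.- q)))

<ᵣ-respʳ : ∀ {x y y′} → y ≈ᵣ y′ → x <ᵣ y → x <ᵣ y′
<ᵣ-respʳ {x} {y} {y′} y≈ (ε , 0<ε , N , h) =
  let (M , k) = y≈ (½ ℚ.* ε) (half-pos 0<ε)
  in ½ ℚ.* ε , half-pos 0<ε , N ℕ.⊔ M , λ n p →
       subst (ℚ._≤ seq y′ n)
         (trans (cong (λ e → (seq x n ℚ.+ e) ℚ.- ½ ℚ.* ε) (sym (halves ε)))
           (solve 2 (λ a e → (a :+ (e :+ e)) :- e := a :+ e) refl (seq x n) (½ ℚ.* ε)))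
         (sub≤ (ℚ.≤-trans (h n (⊔≤ˡ p))
           (ℚ.≤-trans (≤-dist (seq y n) (seq y′ n))
             (ℚ.+-monoʳ-≤ (seq y′ n) (k n (⊔≤ʳ {N} p))))))

<ᵣ-respˡ : ∀ {x x′ y} → x ≈ᵣ x′ → x <ᵣ y → x′ <ᵣ y
<ᵣ-respˡ {x} {x′} {y} x≈ (ε , 0<ε , N , h) =
  let (M , k) = x≈ (½ ℚ.* ε) (half-pos 0<ε)
  in ½ ℚ.* ε , half-pos 0<ε , N ℕ.⊔ M , λ n p → ℚ.≤-trans
       (ℚ.+-monoˡ-≤ (½ ℚ.* ε) (ℚ.≤-trans (≤-dist (seq x′ n) (seq x n))
         (ℚ.+-monoʳ-≤ (seq x n)
           (subst (ℚ._≤ ½ ℚ.* ε) (dist-sym (seq x n) (seq x′ n)) (k n (⊔≤ʳ {N} p))))))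
       (subst (ℚ._≤ seq y n)
         (trans (cong (seq x n ℚ.+_) (sym (halves ε)))
           (sym (ℚ.+-assoc (seq x n) (½ ℚ.* ε) (½ ℚ.* ε))))
         (h n (⊔≤ˡ p)))

ℝ^ : ℕ → Set
ℝ^ n = Fun.Vector ℝ n

infix 4 _≋_

_≋_ : ∀ {n} → ℝ^ n → ℝ^ n → Set
ν ≋ μ = ∀ i → ν i ≈ᵣ μ i

-- The 1-norm.  All norms on ℝⁿ are equivalent, so Lipschitz continuity and
-- differentiability do not depend on this choice.
‖_‖ : ∀ {n} → ℝ^ n → ℝ
‖ ν ‖ = Fun.foldr _+ᵣ_ 0ᵣ (Fun.map ∣_∣ᵣ ν)

infixl 6 _-ᵥ_
infixl 7 _*ᵥ_

_-ᵥ_ : ∀ {n} → ℝ^ n → ℝ^ n → ℝ^ n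
(ν -ᵥ μ) i = ν i -ᵣ μ i

_*ᵥ_ : ∀ {n} → ℝ → ℝ^ n → ℝ^ n
(r *ᵥ ν) i = r *ᵣ ν i

-- A subset of ℝⁿ, i.e. a property of valuations invariant under equality of reals.
record Pred (n : ℕ) : Set₁ where
  field
    holds : ℝ^ n → Set
    resp  : ∀ {ν μ} → ν ≋ μ → holds ν → holds μ

open Pred public

infix 4 _∈⟦_⟧

_∈⟦_⟧ : ∀ {n} → ℝ^ n → Pred n → Set
ν ∈⟦ π ⟧ = holds π ν

Lipschitz : ∀ {n} → (ℝ^ n → ℝ^ n) → Set
Lipschitz f = ∃[ K ] (∀ ν μ → ‖ f ν -ᵥ f μ ‖ ≤ᵣ K *ᵣ ‖ ν -ᵥ μ ‖)

-- x solves ẋ = f(x), x(0) = ν on [0,∞); its values at negative times are irrelevant.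
record Solution {n} (f : ℝ^ n → ℝ^ n) (ν : ℝ^ n) (x : ℝ → ℝ^ n) : Set where
  field
    start      : x 0ᵣ ≋ ν
    derivative : ∀ t → 0ᵣ ≤ᵣ t → ∀ ε → 0ᵣ <ᵣ ε →
      ∃[ δ ] 0ᵣ <ᵣ δ × (∀ s → 0ᵣ ≤ᵣ s → ∣ s -ᵣ t ∣ᵣ ≤ᵣ δ →
        ‖ (x s -ᵥ x t) -ᵥ (s -ᵣ t) *ᵥ f (x t) ‖ ≤ᵣ ε *ᵣ ∣ s -ᵣ t ∣ᵣ)

-- A predicate over X ∪ X′ is a predicate on the concatenation of ν and ν′.
record Transition (modes actions vars : ℕ) : Set₁ where
  constructor transition
  field
    source : Fin modes
    guard  : Pred vars
    action : Fin actions
    jump   : Pred (vars ℕ.+ vars)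
    target : Fin modes

record HybridAutomaton : Set₂ where
  field
    modes actions vars : ℕ
    M₀          : Subset modes
    Δ           : Transition modes actions vars → Set₁
    I           : Fin modes → Pred vars
    F           : Fin modes → ℝ^ vars → ℝ^ vars
    F-lipschitz : ∀ m → Lipschitz (F m)
    V₀          : Pred vars

module _ (H : HybridAutomaton) where
  open HybridAutomaton H

  record Configuration : Set where
    constructor configuration
    field
      mode      : Fin modes
      valuation : ℝ^ vars
      invariant : valuation ∈⟦ I mode ⟧

  open Configuration

  Initial : Configuration → Set
  Initial c = mode c ∈ M₀ × valuation c ∈⟦ V₀ ⟧

  -- ν ⊕ τ is rendered as x τ, where x is the (unique) solution starting in ν.
  -- The last condition, ν′ ∈ I(m′), is part of c′ being a configuration.
  Step : Configuration → ℝ → Fin actions → Configuration → Set₁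
  Step c t a c′ =
    0ᵣ ≤ᵣ t ×
    (∃[ g ] ∃[ j ] Δ (transition (mode c) g a j (mode c′)) ×
      (∃[ x ] Solution (F (mode c)) (valuation c) x ×
        x t ∈⟦ g ⟧ ×
        (∀ τ → 0ᵣ ≤ᵣ τ → τ ≤ᵣ t → x τ ∈⟦ I (mode c) ⟧) ×
        (x t Fun.++ valuation c′) ∈⟦ j ⟧))

  record Run : Set₁ where
    field
      config  : ℕ → Configuration
      delay   : ℕ → ℝ
      label   : ℕ → Fin actions
      initial : Initial (config 0)
      step    : ∀ i → Step (config i) (delay i) (label i) (config (suc i))

record HybridKripkeStructure : Set₂ where
  field
    automaton : HybridAutomaton
    props     : ℕ
  open HybridAutomaton automaton public
  field
    L : Fin modes → Subset props

open HybridKripkeStructure using (automaton; props)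

traceOf : (K : HybridKripkeStructure) → Run (automaton K) → ℕ → Subset (props K)
traceOf K ρ i = HybridKripkeStructure.L K (Configuration.mode (Run.config ρ i))

Trace : (K : HybridKripkeStructure) → (ℕ → Subset (props K)) → Set₁
Trace K σ = ∃[ ρ ] (∀ i → σ i ≡ traceOf K ρ i)

data LTL (p : ℕ) : Set where
  ⊤′ ⊥′       : LTL p
  atom        : Fin p → LTL p
  ¬′_         : LTL p → LTL p
  _∧′_ _∨′_   : LTL p → LTL p → LTL p
  ○_ ◇_ □_    : LTL p → LTL p
  _U_         : LTL p → LTL p → LTL p

suffix : ∀ {A : Set} → (ℕ → A) → ℕ → (ℕ → A)
suffix σ i k = σ (i ℕ.+ k)

infix 4 _⊨_ _⊨ᴷ_

_⊨_ : ∀ {p} → (ℕ → Subset p) → LTL p → Set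
σ ⊨ ⊤′       = ⊤
σ ⊨ ⊥′       = ⊥
σ ⊨ atom q   = q ∈ σ 0
σ ⊨ ¬′ φ     = ¬ (σ ⊨ φ)
σ ⊨ φ ∧′ ψ   = (σ ⊨ φ) × (σ ⊨ ψ)
σ ⊨ φ ∨′ ψ   = (σ ⊨ φ) ⊎ (σ ⊨ ψ)
σ ⊨ ○ φ      = suffix σ 1 ⊨ φ
σ ⊨ ◇ φ      = ∃[ i ] (suffix σ i ⊨ φ)
σ ⊨ □ φ      = ∀ i → suffix σ i ⊨ φ
σ ⊨ φ U ψ    = ∃[ i ] (suffix σ i ⊨ ψ) × (∀ j → j ℕ.< i → suffix σ j ⊨ φ)

_⊨ᴷ_ : (K : HybridKripkeStructure) → LTL (props K) → Set₁
K ⊨ᴷ φ = ∀ σ → Trace K σ → σ ⊨ φ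

-- Computer programs: the WHILE language over binary trees with a single
-- variable X (the language I of N. D. Jones, "Computability and Complexity
-- from a Programming Perspective"), which is Turing complete.

infixr 5 _∙_

data Data : Set where
  nil : Data
  _∙_ : Data → Data → Data

data Expr : Set where
  X nil′   : Expr
  cons     : Expr → Expr → Expr
  hd tl    : Expr → Expr

evalExpr : Expr → Data → Data
evalExpr X          d = d
evalExpr nil′       d = nil
evalExpr (cons e f) d = evalExpr e d ∙ evalExpr f d
evalExpr (hd e)     d with evalExpr e d
... | nil   = nil
... | a ∙ _ = a
evalExpr (tl e)     d with evalExpr e d
... | nil   = nil
... | _ ∙ b = b

infixr 4 _︔_

data Program : Set where
  X≔_      : Expr → Program
  _︔_      : Program → Program → Program
  while    : Expr → Program → Program

-- run P ∶ d ⇓ e: on input d the program P terminates with output e.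
data run_∶_⇓_ : Program → Data → Data → Set where
  assign : ∀ {e d} → run (X≔ e) ∶ d ⇓ evalExpr e d
  then   : ∀ {P Q d d′ d″} →
           run P ∶ d ⇓ d′ → run Q ∶ d′ ⇓ d″ → run (P ︔ Q) ∶ d ⇓ d″
  exit   : ∀ {e P d} → evalExpr e d ≡ nil → run (while e P) ∶ d ⇓ d
  loop   : ∀ {e P d d′ d″ a b} → evalExpr e d ≡ a ∙ b →
           run P ∶ d ⇓ d′ → run (while e P) ∶ d′ ⇓ d″ → run (while e P) ∶ d ⇓ d″

data Term (n : ℕ) : Set where
  var       : Fin n → Term n
  const     : ℚ → Term n
  _⊕_ _⊗_   : Term n → Term n → Term n
  ⊖_        : Term n → Term n

data Formula (n : ℕ) : Set where
  _≐_ _≺_   : Term n → Term n → Formula n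
  _∧ᶠ_ _∨ᶠ_ : Formula n → Formula n → Formula n
  ¬ᶠ_       : Formula n → Formula n

evalTerm : ∀ {n} → Term n → ℝ^ n → ℝ
evalTerm (var i)   ν = ν i
evalTerm (const q) ν = fromℚ q
evalTerm (s ⊕ t)   ν = evalTerm s ν +ᵣ evalTerm t ν
evalTerm (s ⊗ t)   ν = evalTerm s ν *ᵣ evalTerm t ν
evalTerm (⊖ t)     ν = -ᵣ evalTerm t ν

satisfies : ∀ {n} → Formula n → ℝ^ n → Set
satisfies (s ≐ t)  ν = evalTerm s ν ≈ᵣ evalTerm t ν
satisfies (s ≺ t)  ν = evalTerm s ν <ᵣ evalTerm t ν
satisfies (f ∧ᶠ g) ν = satisfies f ν × satisfies g ν
satisfies (f ∨ᶠ g) ν = satisfies f ν ⊎ satisfies g ν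
satisfies (¬ᶠ f)   ν = ¬ satisfies f ν

evalTerm-cong : ∀ {n} (t : Term n) {ν μ} → ν ≋ μ → evalTerm t ν ≈ᵣ evalTerm t μ
evalTerm-cong (var i)   eq = eq i
evalTerm-cong (const q) eq = ≈ᵣ-refl {fromℚ q}
evalTerm-cong (s ⊕ t) {ν} {μ} eq =
  +ᵣ-cong {evalTerm s ν} {evalTerm s μ} {evalTerm t ν} {evalTerm t μ}
    (evalTerm-cong s eq) (evalTerm-cong t eq)
evalTerm-cong (s ⊗ t) {ν} {μ} eq =
  *ᵣ-cong {evalTerm s ν} {evalTerm s μ} {evalTerm t ν} {evalTerm t μ}
    (evalTerm-cong s eq) (evalTerm-cong t eq)
evalTerm-cong (⊖ t) {ν} {μ} eq = -ᵣ-cong {evalTerm t ν} {evalTerm t μ} (evalTerm-cong t eq)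

satisfies-resp : ∀ {n} (f : Formula n) {ν μ} → ν ≋ μ → satisfies f ν → satisfies f μ
satisfies-resp (s ≐ t) {ν} {μ} eq h =
  ≈ᵣ-trans {evalTerm s μ} {evalTerm s ν} {evalTerm t μ}
    (≈ᵣ-sym {evalTerm s ν} {evalTerm s μ} (evalTerm-cong s eq))
    (≈ᵣ-trans {evalTerm s ν} {evalTerm t ν} {evalTerm t μ} h (evalTerm-cong t eq))
satisfies-resp (s ≺ t) {ν} {μ} eq h =
  <ᵣ-respˡ {evalTerm s ν} {evalTerm s μ} {evalTerm t μ} (evalTerm-cong s eq)
    (<ᵣ-respʳ {evalTerm s ν} {evalTerm t ν} {evalTerm t μ} (evalTerm-cong t eq) h)
satisfies-resp (f ∧ᶠ g) eq (h , k) = satisfies-resp f eq h , satisfies-resp g eq k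
satisfies-resp (f ∨ᶠ g) eq h = Sum.map (satisfies-resp f eq) (satisfies-resp g eq) h
satisfies-resp (¬ᶠ f) {ν} {μ} eq h =
  λ k → h (satisfies-resp f (λ i → ≈ᵣ-sym {ν i} {μ i} (eq i)) k)

⟦_⟧ᶠ : ∀ {n} → Formula n → Pred n
⟦ f ⟧ᶠ = record { holds = satisfies f ; resp = satisfies-resp f }

⟦_⟧ᵛ : ∀ {n} → Vec (Term n) n → ℝ^ n → ℝ^ n
⟦ ts ⟧ᵛ ν i = evalTerm (Vec.lookup ts i) ν

record TransitionSyntax (modes actions vars : ℕ) : Set where
  constructor transitionSyntax
  field
    source : Fin modes
    guard  : Formula vars
    action : Fin actions
    jump   : Formula (vars ℕ.+ vars)
    target : Fin modes

⟦_⟧ᵗ : ∀ {m a n} → TransitionSyntax m a n → Transition m a n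
⟦ transitionSyntax m g a j m′ ⟧ᵗ = transition m ⟦ g ⟧ᶠ a ⟦ j ⟧ᶠ m′

-- Hybrid Kripke structures whose predicates are Boolean combinations of polynomial
-- equations and inequalities and whose flows are polynomial, with rational coefficients.
record Presentation : Set where
  field
    modes actions vars atoms : ℕ
    M₀ : Subset modes
    Δ  : List (TransitionSyntax modes actions vars)
    I  : Vec (Formula vars) modes
    F  : Vec (Vec (Term vars) vars) modes
    V₀ : Formula vars
    L  : Vec (Subset atoms) modes

WellFormed : Presentation → Set
WellFormed S = ∀ m → Lipschitz ⟦ Vec.lookup (Presentation.F S) m ⟧ᵛ

⟦_,_⟧ : (S : Presentation) → WellFormed S → HybridKripkeStructure
⟦ S , wf ⟧ = record
  { automaton = record
    { modes       = modes
    ; actions     = actions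
    ; vars        = vars
    ; M₀          = M₀
    ; Δ           = λ τ → τ List.∈ List.map ⟦_⟧ᵗ Δ
    ; I           = λ m → ⟦ Vec.lookup I m ⟧ᶠ
    ; F           = λ m → ⟦ Vec.lookup F m ⟧ᵛ
    ; F-lipschitz = wf
    ; V₀          = ⟦ V₀ ⟧ᶠ
    }
  ; props = atoms
  ; L     = Vec.lookup L
  }
  where open Presentation S

encℕ : ℕ → Data
encℕ zero    = nil
encℕ (suc n) = nil ∙ encℕ n

encFin : ∀ {n} → Fin n → Data
encFin = encℕ ∘ toℕ

encBool : Bool → Data
encBool false = nil
encBool true  = nil ∙ nil

encℤ : ℤ → Data
encℤ (+ n)    = nil ∙ encℕ n
encℤ -[1+ n ] = (nil ∙ nil) ∙ encℕ n

encℚ : ℚ → Data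
encℚ q = encℤ (ℚ.numerator q) ∙ encℕ (ℚ.denominatorℕ q)

encList : ∀ {A : Set} → (A → Data) → List A → Data
encList enc []       = nil
encList enc (x ∷ xs) = enc x ∙ encList enc xs

encVec : ∀ {A : Set} {n} → (A → Data) → Vec A n → Data
encVec enc = encList enc ∘ Vec.toList

encSubset : ∀ {n} → Subset n → Data
encSubset = encVec encBool

encTerm : ∀ {n} → Term n → Data
encTerm (var i)   = encℕ 0 ∙ encFin i
encTerm (const q) = encℕ 1 ∙ encℚ q
encTerm (s ⊕ t)   = encℕ 2 ∙ encTerm s ∙ encTerm t
encTerm (s ⊗ t)   = encℕ 3 ∙ encTerm s ∙ encTerm t
encTerm (⊖ t)     = encℕ 4 ∙ encTerm t

encFormula : ∀ {n} → Formula n → Data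
encFormula (s ≐ t)  = encℕ 0 ∙ encTerm s ∙ encTerm t
encFormula (s ≺ t)  = encℕ 1 ∙ encTerm s ∙ encTerm t
encFormula (f ∧ᶠ g) = encℕ 2 ∙ encFormula f ∙ encFormula g
encFormula (f ∨ᶠ g) = encℕ 3 ∙ encFormula f ∙ encFormula g
encFormula (¬ᶠ f)   = encℕ 4 ∙ encFormula f

encLTL : ∀ {p} → LTL p → Data
encLTL ⊤′       = encℕ 0 ∙ nil
encLTL ⊥′       = encℕ 1 ∙ nil
encLTL (atom q) = encℕ 2 ∙ encFin q
encLTL (¬′ φ)   = encℕ 3 ∙ encLTL φ
encLTL (φ ∧′ ψ) = encℕ 4 ∙ encLTL φ ∙ encLTL ψ
encLTL (φ ∨′ ψ) = encℕ 5 ∙ encLTL φ ∙ encLTL ψ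
encLTL (○ φ)    = encℕ 6 ∙ encLTL φ
encLTL (◇ φ)    = encℕ 7 ∙ encLTL φ
encLTL (□ φ)    = encℕ 8 ∙ encLTL φ
encLTL (φ U ψ)  = encℕ 9 ∙ encLTL φ ∙ encLTL ψ

encTransition : ∀ {m a n} → TransitionSyntax m a n → Data
encTransition (transitionSyntax m g a j m′) =
  encFin m ∙ encFormula g ∙ encFin a ∙ encFormula j ∙ encFin m′

encPresentation : Presentation → Data
encPresentation S =
  encℕ modes ∙ encℕ actions ∙ encℕ vars ∙ encℕ atoms ∙
  encSubset M₀ ∙ encList encTransition Δ ∙ encVec encFormula I ∙
  encVec (encVec encTerm) F ∙ encFormula V₀ ∙ encVec encSubset L
  where open Presentation S

-- A computer-readable representation of hybrid Kripke structures.  Which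
-- predicates and flows it can express is left open, except that polynomial
-- presentations can be effectively translated into it.  Translating by the identity
-- gives the representation by polynomial presentations themselves, below.
record Representation (ℓ : Level) : Set (lsuc (lsuc 0ℓ) ⊔ˡ lsuc ℓ) where
  field
    _represents_ : Data → HybridKripkeStructure → Set ℓ
    translate    : Program
    translates   : ∀ S (wf : WellFormed S) →
      ∃[ c ] run translate ∶ encPresentation S ⇓ c × c represents ⟦ S , wf ⟧

polynomial : Representation (lsuc (lsuc 0ℓ))
polynomial = record
  { _represents_ = λ c K → ∃[ S ] ∃[ wf ] c ≡ encPresentation S × K ≡ ⟦ S , wf ⟧
  ; translate    = X≔ X
  ; translates   = λ S wf → encPresentation S , assign , S , wf , refl , refl
  }

RunDescription : (ℓ : Level) → Set (lsuc (lsuc 0ℓ) ⊔ˡ lsuc ℓ)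
RunDescription ℓ = (K : HybridKripkeStructure) → Data → Run (automaton K) → Set ℓ

-- An answer is either "yes" or "no", the latter with room for a counterexample.
yes : Data
yes = nil

no : Data → Data
no w = nil ∙ w

Decides : ∀ {ℓ} → Representation ℓ → Program → Set (lsuc (lsuc 0ℓ) ⊔ˡ ℓ)
Decides R P = ∀ c K (φ : LTL (props K)) → c represents K →
  ∃[ out ] run P ∶ (c ∙ encLTL φ) ⇓ out ×
    ((out ≡ yes × K ⊨ᴷ φ) ⊎ (∃[ w ] out ≡ no w × ¬ (K ⊨ᴷ φ)))
  where open Representation R

DecidesWithCounterexample : ∀ {ℓ ℓ′} →
  Representation ℓ → RunDescription ℓ′ → Program → Set (lsuc (lsuc 0ℓ) ⊔ˡ ℓ ⊔ˡ ℓ′)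
DecidesWithCounterexample R describes P = ∀ c K (φ : LTL (props K)) → c represents K →
  ∃[ out ] run P ∶ (c ∙ encLTL φ) ⇓ out ×
    ((out ≡ yes × K ⊨ᴷ φ) ⊎
     (∃[ w ] ∃[ ρ ] out ≡ no w × describes K w ρ × ¬ (traceOf K ρ ⊨ φ)))
  where open Representation R

{-# OPTIONS --safe #-}

-- The binary trees on which programs compute are coded by natural numbers through Cantor's
-- pairing polynomial, so that a universal stack machine, given by finitely many rewrite rules on
-- trees, becomes a hybrid automaton with polynomial guards and jumps: a rule with metavariables is
-- applied by guessing the codes of their values.  Time is kept from passing by a clock of slope 1
-- that the invariants force to be 0.  Along the runs the formula □ ¬ halted then fails precisely
-- when the simulated program terminates with the answer "yes".  Given a decision procedure P, let Q
-- be the program that turns a number m into the automaton simulating the program with code m on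
-- input m and then runs P on it; on its own code, Q contradicts the answer of P.

module Submission where

open import Defs
open import Data.Empty using (⊥-elim)
open import Data.Fin.Base using (Fin; zero; suc; _↑ˡ_; _↑ʳ_; splitAt)
open import Data.Fin.Patterns using (0F; 1F; 2F; 3F; 4F; 5F)
open import Data.Fin.Subset using (Subset; inside; outside; _∈_; ⁅_⁆)
open import Data.Fin.Subset.Properties using (x∈⁅x⁆; x∈⁅y⁆⇒x≡y)
import Data.Integer.Base as ℤ
import Data.Integer.Properties as ℤ
open import Data.List.Base as List using (List; []; _∷_; _++_; allFin)
open import Data.List.Membership.Propositional using () renaming (_∈_ to _∈ˡ_)
open import Data.List.Membership.Propositional.Properties using (∈-map⁺; ∈-map⁻; ∈-++⁺ˡ; ∈-++⁺ʳ; ∈-++⁻; ∈-allFin)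
open import Data.List.Relation.Unary.All as All using (All; []; _∷_)
open import Data.List.Relation.Unary.Any using (here; there)
open import Data.Maybe.Base using (Maybe; just; nothing)
open import Data.Maybe.Properties using (just-injective)
open import Data.Nat.Base as ℕ using (ℕ; zero; suc)
import Data.Nat.Coprimality as Coprime
open import Data.Nat.Induction using (<-rec)
import Data.Nat.Properties as ℕ
open import Data.Product.Base using (∃-syntax; _×_; _,_; proj₁; proj₂)
open import Data.Product.Properties using (,-injective)
open import Data.Rational.Base as ℚ using (ℚ; mkℚ; 0ℚ; 1ℚ; ½)
import Data.Rational.Properties as ℚ
open import Data.Rational.Solver using (module +-*-Solver)
import Data.Rational.Unnormalised.Base as ℚᵘ
import Data.Rational.Unnormalised.Properties as ℚᵘ
open import Data.Sum.Base using (_⊎_; inj₁; inj₂)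
open import Data.Vec.Base as Vec using (Vec; []; _∷_)
import Data.Vec.Functional as Fun
import Data.Vec.Functional.Properties as Fun
import Data.Vec.Properties as Vec
open import Function.Base using (_∘_)
open import Relation.Binary.Construct.Closure.ReflexiveTransitive using (Star; _◅_; _◅◅_; gmap) renaming (ε to done)
open import Relation.Binary.PropositionalEquality using (_≡_; refl; sym; trans; cong; cong₂; subst; subst₂; module ≡-Reasoning)
import Relation.Nullary.Decidable.Core as Dec
open import Relation.Nullary.Negation.Core using (¬_)

open +-*-Solver using (solve; _:=_; _:+_; _:*_; _:-_; :-_; con)

-- Cantor's pairing function and the coding of trees by natural numbers.

triangle : ℕ → ℕ
triangle zero    = 0
triangle (suc n) = suc n ℕ.+ triangle n

pair : ℕ → ℕ → ℕ
pair a b = triangle (a ℕ.+ b) ℕ.+ b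

-- Walks along the antidiagonals of constant sum, moving on to the next one when the first component
-- is used up; each move raises `pair` by exactly 1.
next : ℕ × ℕ → ℕ × ℕ
next (zero  , b) = suc b , 0
next (suc a , b) = a , suc b

unpair : ℕ → ℕ × ℕ
unpair zero    = 0 , 0
unpair (suc n) = next (unpair n)

pair-suc : ∀ a b → pair a (suc b) ≡ suc (pair (suc a) b)
pair-suc a b = trans (cong (λ c → triangle c ℕ.+ suc b) (ℕ.+-suc a b)) (ℕ.+-suc (triangle (suc a ℕ.+ b)) b)

pair-zero : ∀ a → pair (suc a) 0 ≡ suc (pair 0 a)
pair-zero a rewrite ℕ.+-identityʳ a | ℕ.+-identityʳ (a ℕ.+ triangle a) = cong suc (ℕ.+-comm a (triangle a))

-- The induction is on the code `n`, since stepping back in the enumeration may raise either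
-- component.
unpair-pair : ∀ n a b → pair a b ≡ n → unpair n ≡ (a , b)
unpair-pair zero    zero    zero    _  = refl
unpair-pair (suc n) (suc a) zero    eq =
  cong next (unpair-pair n 0 a (ℕ.suc-injective (trans (sym (pair-zero a)) eq)))
unpair-pair zero    (suc a) zero    ()
unpair-pair zero    a       (suc b) eq with trans (sym eq) (pair-suc a b)
... | ()
unpair-pair (suc n) a       (suc b) eq =
  cong next (unpair-pair n (suc a) b (ℕ.suc-injective (trans (sym (pair-suc a b)) eq)))

pair-unpair : ∀ n → pair (proj₁ (unpair n)) (proj₂ (unpair n)) ≡ n
pair-unpair zero = refl
pair-unpair (suc n) with unpair n | pair-unpair n
... | zero  , b | eq = trans (pair-zero b) (cong suc eq)
... | suc a , b | eq = trans (pair-suc a b) (cong suc eq)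

n≤triangle : ∀ n → n ℕ.≤ triangle n
n≤triangle zero    = ℕ.z≤n
n≤triangle (suc n) = ℕ.m≤m+n (suc n) (triangle n)

code : Data → ℕ
code nil     = 0
code (a ∙ b) = suc (pair (code a) (code b))

code-injective : ∀ D E → code D ≡ code E → D ≡ E
code-injective nil     nil     _  = refl
code-injective (a ∙ b) (c ∙ d) eq =
  let (p , q) = ,-injective (trans (sym (unpair-pair _ (code a) (code b) (ℕ.suc-injective eq)))
                                   (unpair-pair _ (code c) (code d) refl))
  in cong₂ _∙_ (code-injective a c p) (code-injective b d q)

-- Thanks to surjectivity any register contents denote a substitution, so no guard has to check that
-- a guessed number is a code. Both components of `unpair n` are at most `n`, which justifies the
-- recursion.
code-surjective : ∀ n → ∃[ D ] code D ≡ n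
code-surjective = <-rec _ λ where
  zero    rec → nil , refl
  (suc n) rec →
    let (a , b) = unpair n
        a+b≤n   = subst (a ℕ.+ b ℕ.≤_) (pair-unpair n) (ℕ.≤-trans (n≤triangle (a ℕ.+ b)) (ℕ.m≤m+n _ b))
        (D , p) = rec (ℕ.s≤s (ℕ.≤-trans (ℕ.m≤m+n a b) a+b≤n))
        (E , q) = rec (ℕ.s≤s (ℕ.≤-trans (ℕ.m≤n+m b a) a+b≤n))
    in D ∙ E , cong suc (trans (cong₂ pair p q) (pair-unpair n))

-- Tree rewriting and the universal stack machine.

data Pattern (k : ℕ) : Set where
  meta : Fin k → Pattern k
  leaf : Pattern k
  _▵_  : Pattern k → Pattern k → Pattern k

infixr 5 _▵_

instantiate : ∀ {k} → (Fin k → Data) → Pattern k → Data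
instantiate σ (meta i) = σ i
instantiate σ leaf     = nil
instantiate σ (p ▵ q)  = instantiate σ p ∙ instantiate σ q

closed : ∀ {k} → Data → Pattern k
closed nil     = leaf
closed (a ∙ b) = closed a ▵ closed b

infix 4 _⊢_⟶_

-- Rules act at the root only, so that applying a rule is one guard and one jump on the code of the
-- whole tree.
data _⊢_⟶_ {k} (rs : List (Pattern k × Pattern k)) : Data → Data → Set where
  rewriting : ∀ {l r} → (l , r) ∈ˡ rs → (σ : Vec Data k) →
              rs ⊢ instantiate (Vec.lookup σ) l ⟶ instantiate (Vec.lookup σ) r

-- A universal stack machine on trees.  A state is K ∙ S ∙ d with a list K of
-- instructions, a stack S of intermediate values and the value d of the variable X.
pattern LOAD    = nil
pattern NIL     = nil ∙ nil
pattern CONS    = nil ∙ nil ∙ nil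
pattern HEAD    = nil ∙ nil ∙ nil ∙ nil
pattern TAIL    = nil ∙ nil ∙ nil ∙ nil ∙ nil
pattern STORE   = nil ∙ nil ∙ nil ∙ nil ∙ nil ∙ nil
pattern TEST c  = (nil ∙ nil) ∙ c
pattern SEQ a b = (nil ∙ nil ∙ nil) ∙ a ∙ b

rules : List (Pattern 6 × Pattern 6)
rules =
  ((closed LOAD ▵ K) ▵ S ▵ d                , K ▵ (d ▵ S) ▵ d) ∷
  ((closed NIL ▵ K) ▵ S ▵ d                 , K ▵ (leaf ▵ S) ▵ d) ∷
  ((closed CONS ▵ K) ▵ (b ▵ a ▵ S) ▵ d      , K ▵ ((a ▵ b) ▵ S) ▵ d) ∷
  ((closed HEAD ▵ K) ▵ (leaf ▵ S) ▵ d       , K ▵ (leaf ▵ S) ▵ d) ∷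
  ((closed HEAD ▵ K) ▵ ((a ▵ b) ▵ S) ▵ d    , K ▵ (a ▵ S) ▵ d) ∷
  ((closed TAIL ▵ K) ▵ (leaf ▵ S) ▵ d       , K ▵ (leaf ▵ S) ▵ d) ∷
  ((closed TAIL ▵ K) ▵ ((a ▵ b) ▵ S) ▵ d    , K ▵ (b ▵ S) ▵ d) ∷
  ((closed STORE ▵ K) ▵ (a ▵ S) ▵ d         , K ▵ S ▵ a) ∷
  ((test c ▵ K) ▵ (leaf ▵ S) ▵ d            , K ▵ S ▵ d) ∷
  ((test c ▵ K) ▵ ((a ▵ b) ▵ S) ▵ d         , (c ▵ test c ▵ K) ▵ S ▵ d) ∷
  ((sequence a b ▵ K) ▵ S ▵ d               , (a ▵ b ▵ K) ▵ S ▵ d) ∷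
  []
  where
  K S d a b c : Pattern 6
  K = meta 0F
  S = meta 1F
  d = meta 2F
  a = meta 3F
  b = meta 4F
  c = meta 5F
  test : Pattern 6 → Pattern 6
  test p = closed (nil ∙ nil) ▵ p
  sequence : Pattern 6 → Pattern 6 → Pattern 6
  sequence p q = closed (nil ∙ nil ∙ nil) ▵ p ▵ q

-- A partial function that contains every rewriting step: it exhibits the machine as deterministic,
-- and `nothing` certifies a normal form.
step : Data → Maybe Data
step ((LOAD ∙ K) ∙ S ∙ d)               = just (K ∙ (d ∙ S) ∙ d)
step ((NIL ∙ K) ∙ S ∙ d)                = just (K ∙ (nil ∙ S) ∙ d)
step ((CONS ∙ K) ∙ (b ∙ a ∙ S) ∙ d)     = just (K ∙ ((a ∙ b) ∙ S) ∙ d)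
step ((HEAD ∙ K) ∙ (nil ∙ S) ∙ d)       = just (K ∙ (nil ∙ S) ∙ d)
step ((HEAD ∙ K) ∙ ((a ∙ b) ∙ S) ∙ d)   = just (K ∙ (a ∙ S) ∙ d)
step ((TAIL ∙ K) ∙ (nil ∙ S) ∙ d)       = just (K ∙ (nil ∙ S) ∙ d)
step ((TAIL ∙ K) ∙ ((a ∙ b) ∙ S) ∙ d)   = just (K ∙ (b ∙ S) ∙ d)
step ((STORE ∙ K) ∙ (a ∙ S) ∙ d)        = just (K ∙ S ∙ a)
step ((TEST c ∙ K) ∙ (nil ∙ S) ∙ d)     = just (K ∙ S ∙ d)
step ((TEST c ∙ K) ∙ ((a ∙ b) ∙ S) ∙ d) = just ((c ∙ TEST c ∙ K) ∙ S ∙ d)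
step ((SEQ a b ∙ K) ∙ S ∙ d)            = just ((a ∙ b ∙ K) ∙ S ∙ d)
step _                                  = nothing

infix 4 _⟶_ _⟶*_

_⟶_ : Data → Data → Set
_⟶_ = rules ⊢_⟶_

_⟶*_ : Data → Data → Set
_⟶*_ = Star _⟶_

⟶-step : ∀ {D E} → D ⟶ E → step D ≡ just E
⟶-step (rewriting r∈ σ) = All.lookup rules-sound r∈ σ
  where
  rules-sound : All (λ (l , r) → (σ : Vec Data 6) →
    step (instantiate (Vec.lookup σ) l) ≡ just (instantiate (Vec.lookup σ) r)) rules
  -- Each left-hand side shows enough constructors for `step` to compute while the metavariables
  -- stay open.
  rules-sound =
    (λ _ → refl) ∷ (λ _ → refl) ∷ (λ _ → refl) ∷ (λ _ → refl) ∷ (λ _ → refl) ∷ (λ _ → refl) ∷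
    (λ _ → refl) ∷ (λ _ → refl) ∷ (λ _ → refl) ∷ (λ _ → refl) ∷ (λ _ → refl) ∷ []

-- Determinism lines the two reductions up. This is what keeps a program that terminates with "no"
-- from also reaching the accepting state.
normal-unique : ∀ {D E F} → step E ≡ nothing → step F ≡ nothing → D ⟶* E → D ⟶* F → E ≡ F
normal-unique nE nF done     done     = refl
normal-unique nE nF done     (s ◅ _)  with () ← trans (sym nE) (⟶-step s)
normal-unique nE nF (s ◅ _)  done     with () ← trans (sym nF) (⟶-step s)
normal-unique nE nF (s ◅ ss) (t ◅ ts)
  with refl ← just-injective (trans (sym (⟶-step s)) (⟶-step t)) = normal-unique nE nF ss ts

-- Compilation of WHILE programs to the stack machine.

compileExpr : Expr → Data
compileExpr X          = LOAD
compileExpr nil′       = NIL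
compileExpr (cons e f) = SEQ (compileExpr e) (SEQ (compileExpr f) CONS)
compileExpr (hd e)     = SEQ (compileExpr e) HEAD
compileExpr (tl e)     = SEQ (compileExpr e) TAIL

-- A loop needs no jump addresses: on a non-nil condition `TEST` schedules the body, the condition
-- and itself again.
compile : Program → Data
compile (X≔ e)      = SEQ (compileExpr e) STORE
compile (P ︔ Q)     = SEQ (compile P) (compile Q)
compile (while e P) = SEQ (compileExpr e) (TEST (SEQ (compile P) (compileExpr e)))

module _ {K S d : Data} where

  load-step : (LOAD ∙ K) ∙ S ∙ d ⟶ K ∙ (d ∙ S) ∙ d
  load-step = rewriting (here refl) (K ∷ S ∷ d ∷ nil ∷ nil ∷ nil ∷ [])

  nil-step : (NIL ∙ K) ∙ S ∙ d ⟶ K ∙ (nil ∙ S) ∙ d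
  nil-step = rewriting (there (here refl)) (K ∷ S ∷ d ∷ nil ∷ nil ∷ nil ∷ [])

  cons-step : ∀ {a b} → (CONS ∙ K) ∙ (b ∙ a ∙ S) ∙ d ⟶ K ∙ ((a ∙ b) ∙ S) ∙ d
  cons-step {a} {b} = rewriting (there (there (here refl))) (K ∷ S ∷ d ∷ a ∷ b ∷ nil ∷ [])

  head-nil-step : (HEAD ∙ K) ∙ (nil ∙ S) ∙ d ⟶ K ∙ (nil ∙ S) ∙ d
  head-nil-step = rewriting (there (there (there (here refl)))) (K ∷ S ∷ d ∷ nil ∷ nil ∷ nil ∷ [])

  head-step : ∀ {a b} → (HEAD ∙ K) ∙ ((a ∙ b) ∙ S) ∙ d ⟶ K ∙ (a ∙ S) ∙ d
  head-step {a} {b} =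
    rewriting (there (there (there (there (here refl))))) (K ∷ S ∷ d ∷ a ∷ b ∷ nil ∷ [])

  tail-nil-step : (TAIL ∙ K) ∙ (nil ∙ S) ∙ d ⟶ K ∙ (nil ∙ S) ∙ d
  tail-nil-step =
    rewriting (there (there (there (there (there (here refl)))))) (K ∷ S ∷ d ∷ nil ∷ nil ∷ nil ∷ [])

  tail-step : ∀ {a b} → (TAIL ∙ K) ∙ ((a ∙ b) ∙ S) ∙ d ⟶ K ∙ (b ∙ S) ∙ d
  tail-step {a} {b} =
    rewriting (there (there (there (there (there (there (here refl)))))))
      (K ∷ S ∷ d ∷ a ∷ b ∷ nil ∷ [])

  store-step : ∀ {a} → (STORE ∙ K) ∙ (a ∙ S) ∙ d ⟶ K ∙ S ∙ a
  store-step {a} =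
    rewriting (there (there (there (there (there (there (there (here refl))))))))
      (K ∷ S ∷ d ∷ a ∷ nil ∷ nil ∷ [])

  test-nil-step : ∀ {c} → (TEST c ∙ K) ∙ (nil ∙ S) ∙ d ⟶ K ∙ S ∙ d
  test-nil-step {c} =
    rewriting (there (there (there (there (there (there (there (there (here refl)))))))))
      (K ∷ S ∷ d ∷ nil ∷ nil ∷ c ∷ [])

  test-step : ∀ {a b c} → (TEST c ∙ K) ∙ ((a ∙ b) ∙ S) ∙ d ⟶ (c ∙ TEST c ∙ K) ∙ S ∙ d
  test-step {a} {b} {c} =
    rewriting (there (there (there (there (there (there (there (there (there (here refl))))))))))
      (K ∷ S ∷ d ∷ a ∷ b ∷ c ∷ [])

  seq-step : ∀ {a b} → (SEQ a b ∙ K) ∙ S ∙ d ⟶ (a ∙ b ∙ K) ∙ S ∙ d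
  seq-step {a} {b} =
    rewriting (there (there (there (there (there (there (there (there (there (there
      (here refl))))))))))) (K ∷ S ∷ d ∷ a ∷ b ∷ nil ∷ [])

eval-steps : ∀ e {K S d} → (compileExpr e ∙ K) ∙ S ∙ d ⟶* K ∙ (evalExpr e d ∙ S) ∙ d
eval-steps X          = load-step ◅ done
eval-steps nil′       = nil-step ◅ done
eval-steps (cons e f) =
  seq-step ◅ eval-steps e ◅◅ seq-step ◅ eval-steps f ◅◅ cons-step ◅ done
eval-steps (hd e) {K} {S} {d} with evalExpr e d | eval-steps e {HEAD ∙ K} {S} {d}
... | nil   | steps = seq-step ◅ steps ◅◅ head-nil-step ◅ done
... | a ∙ b | steps = seq-step ◅ steps ◅◅ head-step ◅ done
eval-steps (tl e) {K} {S} {d} with evalExpr e d | eval-steps e {TAIL ∙ K} {S} {d}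
... | nil   | steps = seq-step ◅ steps ◅◅ tail-nil-step ◅ done
... | a ∙ b | steps = seq-step ◅ steps ◅◅ tail-step ◅ done

eval-steps-≡ : ∀ e {K S d v} → evalExpr e d ≡ v → (compileExpr e ∙ K) ∙ S ∙ d ⟶* K ∙ (v ∙ S) ∙ d
eval-steps-≡ e refl = eval-steps e

run-steps : ∀ {P d d′ K S} → run P ∶ d ⇓ d′ → (compile P ∙ K) ∙ S ∙ d ⟶* K ∙ S ∙ d′
-- From the second iteration on, the loop is no longer a single instruction but a condition followed
-- by `TEST`; the induction runs over this unfolded form.
while-steps : ∀ {e P d d′ K S} → run (while e P) ∶ d ⇓ d′ →
  (compileExpr e ∙ TEST (SEQ (compile P) (compileExpr e)) ∙ K) ∙ S ∙ d ⟶* K ∙ S ∙ d′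

run-steps (assign {e})     = seq-step ◅ eval-steps e ◅◅ store-step ◅ done
run-steps (then r s)       = seq-step ◅ run-steps r ◅◅ run-steps s
run-steps r@(exit _)       = seq-step ◅ while-steps r
run-steps r@(loop _ _ _)   = seq-step ◅ while-steps r

while-steps {e} (exit e≡nil)       = eval-steps-≡ e e≡nil ◅◅ test-nil-step ◅ done
while-steps {e} (loop e≡a∙b r s)   =
  eval-steps-≡ e e≡a∙b ◅◅ test-step ◅ seq-step ◅ run-steps r ◅◅ while-steps s

initialState : Data → Data → Data
initialState p d = (p ∙ nil) ∙ nil ∙ d

acceptingState : Data
acceptingState = nil ∙ nil ∙ yes

run-accepting : ∀ {P d} → run P ∶ d ⇓ yes → initialState (compile P) d ⟶* acceptingState
run-accepting = run-steps

run-rejecting : ∀ {P d w} → run P ∶ d ⇓ no w → ¬ (initialState (compile P) d ⟶* acceptingState)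
run-rejecting r acc with () ← normal-unique refl refl (run-steps r) acc

-- Codes of trees as values of rational polynomials.

-- Given by mkℚ, so that the numerator (and with it encℚ) computes.
fromℕ : ℕ → ℚ
fromℕ n = mkℚ (ℤ.+ n) 0 (Coprime.sym (Coprime.1-coprimeTo n))

fromℕ-suc : ∀ n → fromℕ (suc n) ≡ 1ℚ ℚ.+ fromℕ n
fromℕ-suc n = ℚ.toℚᵘ-injective (ℚᵘ.≃-sym (ℚᵘ.≃-trans (ℚ.toℚᵘ-homo-+ 1ℚ (fromℕ n))
  (ℚᵘ.*≡* (cong (λ m → (ℤ.+ 1 ℤ.+ m) ℤ.* ℤ.+ 1) (ℤ.*-identityʳ (ℤ.+ n))))))

fromℕ-+ : ∀ m n → fromℕ (m ℕ.+ n) ≡ fromℕ m ℚ.+ fromℕ n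
fromℕ-+ zero    n = sym (ℚ.+-identityˡ (fromℕ n))
fromℕ-+ (suc m) n = begin
  fromℕ (suc (m ℕ.+ n))           ≡⟨ fromℕ-suc (m ℕ.+ n) ⟩
  1ℚ ℚ.+ fromℕ (m ℕ.+ n)          ≡⟨ cong (1ℚ ℚ.+_) (fromℕ-+ m n) ⟩
  1ℚ ℚ.+ (fromℕ m ℚ.+ fromℕ n)    ≡⟨ ℚ.+-assoc 1ℚ (fromℕ m) (fromℕ n) ⟨
  1ℚ ℚ.+ fromℕ m ℚ.+ fromℕ n      ≡⟨ cong (ℚ._+ fromℕ n) (fromℕ-suc m) ⟨
  fromℕ (suc m) ℚ.+ fromℕ n       ∎
  where open ≡-Reasoning

fromℕ-triangle : ∀ n → fromℕ (triangle n) ≡ ½ ℚ.* (fromℕ n ℚ.* (1ℚ ℚ.+ fromℕ n))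
fromℕ-triangle zero    = refl
fromℕ-triangle (suc n) = begin
  fromℕ (suc n ℕ.+ triangle n)
    ≡⟨ fromℕ-+ (suc n) (triangle n) ⟩
  fromℕ (suc n) ℚ.+ fromℕ (triangle n)
    ≡⟨ cong₂ ℚ._+_ (fromℕ-suc n) (fromℕ-triangle n) ⟩
  (1ℚ ℚ.+ x) ℚ.+ ½ ℚ.* (x ℚ.* (1ℚ ℚ.+ x))
    ≡⟨ solve 1 (λ x → (con 1ℚ :+ x) :+ con ½ :* (x :* (con 1ℚ :+ x)) :=
                      con ½ :* ((con 1ℚ :+ x) :* (con 1ℚ :+ (con 1ℚ :+ x)))) refl x ⟩
  ½ ℚ.* ((1ℚ ℚ.+ x) ℚ.* (1ℚ ℚ.+ (1ℚ ℚ.+ x)))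
    ≡⟨ cong (λ y → ½ ℚ.* (y ℚ.* (1ℚ ℚ.+ y))) (fromℕ-suc n) ⟨
  ½ ℚ.* (fromℕ (suc n) ℚ.* (1ℚ ℚ.+ fromℕ (suc n))) ∎
  where
  open ≡-Reasoning
  x = fromℕ n

-- The polynomial of `suc (pair a b)`, the code of a node in terms of the codes of its subtrees.
consTerm : ∀ {n} → Term n → Term n → Term n
consTerm s t = const 1ℚ ⊕ ((const ½ ⊗ ((s ⊕ t) ⊗ (const 1ℚ ⊕ (s ⊕ t)))) ⊕ t)

patternTerm : ∀ {k n} → (Fin k → Term n) → Pattern k → Term n
patternTerm f (meta i) = f i
patternTerm f leaf     = const 0ℚ
patternTerm f (p ▵ q)  = consTerm (patternTerm f p) (patternTerm f q)

-- Equality of representing sequences with constant sequences, which is preserved by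
-- the term constructors definitionally, as opposed to _≈ᵣ_.
_≗ℕ_ : ℝ → ℕ → Set
x ≗ℕ n = ∀ m → seq x m ≡ fromℕ n

consTerm-≗ : ∀ {n} s t (ν : ℝ^ n) a b →
  evalTerm s ν ≗ℕ a → evalTerm t ν ≗ℕ b → evalTerm (consTerm s t) ν ≗ℕ suc (pair a b)
consTerm-≗ s t ν a b hs ht m = begin
  1ℚ ℚ.+ (½ ℚ.* ((x ℚ.+ y) ℚ.* (1ℚ ℚ.+ (x ℚ.+ y))) ℚ.+ y)
    ≡⟨ cong₂ (λ x y → 1ℚ ℚ.+ (½ ℚ.* ((x ℚ.+ y) ℚ.* (1ℚ ℚ.+ (x ℚ.+ y))) ℚ.+ y)) (hs m) (ht m) ⟩
  1ℚ ℚ.+ (½ ℚ.* ((fromℕ a ℚ.+ fromℕ b) ℚ.* (1ℚ ℚ.+ (fromℕ a ℚ.+ fromℕ b))) ℚ.+ fromℕ b)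
    ≡⟨ cong (λ z → 1ℚ ℚ.+ (½ ℚ.* (z ℚ.* (1ℚ ℚ.+ z)) ℚ.+ fromℕ b)) (fromℕ-+ a b) ⟨
  1ℚ ℚ.+ (½ ℚ.* (fromℕ (a ℕ.+ b) ℚ.* (1ℚ ℚ.+ fromℕ (a ℕ.+ b))) ℚ.+ fromℕ b)
    ≡⟨ cong (λ z → 1ℚ ℚ.+ (z ℚ.+ fromℕ b)) (fromℕ-triangle (a ℕ.+ b)) ⟨
  1ℚ ℚ.+ (fromℕ (triangle (a ℕ.+ b)) ℚ.+ fromℕ b)
    ≡⟨ cong (1ℚ ℚ.+_) (fromℕ-+ (triangle (a ℕ.+ b)) b) ⟨
  1ℚ ℚ.+ fromℕ (pair a b)
    ≡⟨ fromℕ-suc (pair a b) ⟨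
  fromℕ (suc (pair a b)) ∎
  where
  open ≡-Reasoning
  x = seq (evalTerm s ν) m
  y = seq (evalTerm t ν) m

patternTerm-≗ : ∀ {k n} (f : Fin k → Term n) σ (ν : ℝ^ n) → (∀ i → evalTerm (f i) ν ≗ℕ code (σ i)) →
  ∀ p → evalTerm (patternTerm f p) ν ≗ℕ code (instantiate σ p)
patternTerm-≗ f σ ν h (meta i) = h i
patternTerm-≗ f σ ν h leaf     = λ _ → refl
patternTerm-≗ f σ ν h (p ▵ q)  =
  consTerm-≗ (patternTerm f p) (patternTerm f q) ν (code (instantiate σ p)) (code (instantiate σ q))
    (patternTerm-≗ f σ ν h p) (patternTerm-≗ f σ ν h q)

-- Equality and order of Cauchy reals, and the 1-norm.

≗⇒≈ᵣ : ∀ {x y} → (∀ n → seq x n ≡ seq y n) → x ≈ᵣ y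
≗⇒≈ᵣ {x} {y} x≗y ε 0<ε = 0 , λ n _ → subst (ℚ._≤ ε)
  (sym (trans (cong (λ z → ℚ.∣ z ℚ.- seq y n ∣) (x≗y n)) (cong ℚ.∣_∣ (ℚ.+-inverseʳ (seq y n)))))
  (ℚ.<⇒≤ 0<ε)

½-positive : ∀ {ε} → 0ℚ ℚ.< ε → 0ℚ ℚ.< ½ ℚ.* ε
½-positive {ε} 0<ε = subst (ℚ._< ½ ℚ.* ε) (ℚ.*-zeroʳ ½) (ℚ.*-monoʳ-<-pos ½ 0<ε)

½-double : ∀ ε → ½ ℚ.* ε ℚ.+ ½ ℚ.* ε ≡ ε
½-double ε = trans (sym (ℚ.*-distribʳ-+ ε ½ ½)) (ℚ.*-identityˡ ε)

½< : ∀ {ε} → 0ℚ ℚ.< ε → ½ ℚ.* ε ℚ.< ε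
½< {ε} 0<ε = subst₂ ℚ._<_ (ℚ.+-identityʳ (½ ℚ.* ε)) (½-double ε)
  (ℚ.+-monoʳ-< (½ ℚ.* ε) (½-positive 0<ε))

-- The order on ℚ is decidable, so it suffices to refute a positive distance, with half of it as the
-- tolerance.
fromℚ-injective : ∀ {p q} → fromℚ p ≈ᵣ fromℚ q → p ≡ q
fromℚ-injective {p} {q} p≈q with ℚ.∣ p ℚ.- q ∣ ℚ.≤? 0ℚ
... | Dec.yes ≤0 = begin
  p                ≡⟨ solve 2 (λ p q → p := (p :- q) :+ q) refl p q ⟩
  p ℚ.- q ℚ.+ q    ≡⟨ cong (ℚ._+ q) (ℚ.∣p∣≡0⇒p≡0 (p ℚ.- q) (ℚ.≤-antisym ≤0 (ℚ.0≤∣p∣ (p ℚ.- q)))) ⟩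
  0ℚ ℚ.+ q         ≡⟨ ℚ.+-identityˡ q ⟩
  q                ∎
  where open ≡-Reasoning
... | Dec.no ≰0 =
  let 0<∣p-q∣ = ℚ.≰⇒> ≰0
      (N , h) = p≈q _ (½-positive 0<∣p-q∣)
  in ⊥-elim (ℚ.<-irrefl refl (ℚ.≤-<-trans (h N ℕ.≤-refl) (½< 0<∣p-q∣)))

fromℕ-injective : ∀ {m n} → fromℚ (fromℕ m) ≈ᵣ fromℚ (fromℕ n) → m ≡ n
fromℕ-injective {m} {n} eq = ℤ.+-injective (cong ℚ.numerator (fromℚ-injective {fromℕ m} {fromℕ n} eq))

p≤∣p∣ : ∀ p → p ℚ.≤ ℚ.∣ p ∣
p≤∣p∣ p with ℚ.≤-total p 0ℚ
... | inj₁ p≤0 = ℚ.≤-trans p≤0 (ℚ.0≤∣p∣ p)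
... | inj₂ 0≤p = ℚ.≤-reflexive (sym (ℚ.0≤p⇒∣p∣≡p 0≤p))

p≤q+∣p-q∣ : ∀ p q → p ℚ.≤ q ℚ.+ ℚ.∣ p ℚ.- q ∣
p≤q+∣p-q∣ p q = subst (ℚ._≤ q ℚ.+ ℚ.∣ p ℚ.- q ∣)
  (solve 2 (λ p q → q :+ (p :- q) := p) refl p q)
  (ℚ.+-monoʳ-≤ q (p≤∣p∣ (p ℚ.- q)))

+-cancelʳ-≤ : ∀ r {p q} → p ℚ.+ r ℚ.≤ q ℚ.+ r → p ℚ.≤ q
+-cancelʳ-≤ r {p} {q} h = subst₂ ℚ._≤_ (cancel p) (cancel q) (ℚ.+-monoˡ-≤ (ℚ.- r) h)
  where
  cancel : ∀ p → p ℚ.+ r ℚ.- r ≡ p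
  cancel p = solve 2 (λ p r → p :+ r :- r := p) refl p r

-- All entries from `N` on lie within ε/2 of this one and hence are at least ε/2.
entry-positive : ∀ x {ε} → 0ℚ ℚ.< ε → ∀ {N} →
  (∀ m n → N ℕ.≤ m → N ℕ.≤ n → ℚ.∣ seq x m ℚ.- seq x n ∣ ℚ.≤ ½ ℚ.* ε) →
  ∀ {n} → N ℕ.≤ n → ε ℚ.≤ seq x n → 0ᵣ <ᵣ x
entry-positive x {ε} 0<ε {N} h {n} N≤n ε≤xn = ½ ℚ.* ε , ½-positive 0<ε , N , λ m N≤m →
  subst (ℚ._≤ seq x m) (sym (ℚ.+-identityˡ (½ ℚ.* ε)))
    (+-cancelʳ-≤ (½ ℚ.* ε) (begin
      ½ ℚ.* ε ℚ.+ ½ ℚ.* ε                        ≡⟨ ½-double ε ⟩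
      ε                                          ≤⟨ ε≤xn ⟩
      seq x n                                    ≤⟨ p≤q+∣p-q∣ (seq x n) (seq x m) ⟩
      seq x m ℚ.+ ℚ.∣ seq x n ℚ.- seq x m ∣      ≤⟨ ℚ.+-monoʳ-≤ (seq x m) (h n m N≤n N≤m) ⟩
      seq x m ℚ.+ ½ ℚ.* ε                        ∎))
  where open ℚ.≤-Reasoning

-- Rational entries can be compared with ε; a late entry of absolute value ε or more would make `x`
-- or `-ᵣ x` positive by `entry-positive`.
≈0-intro : ∀ x → ¬ (0ᵣ <ᵣ x) → ¬ (0ᵣ <ᵣ -ᵣ x) → x ≈ᵣ 0ᵣ
≈0-intro x x≯0 -x≯0 ε 0<ε =
  let (N , h) = cauchy x (½ ℚ.* ε) (½-positive 0<ε)
      (M , k) = cauchy (-ᵣ x) (½ ℚ.* ε) (½-positive 0<ε)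
  in N ℕ.⊔ M , λ n p → bound (seq x n)
       (λ ε≤xn → x≯0 (entry-positive x 0<ε h (ℕ.m⊔n≤o⇒m≤o N M p) ε≤xn))
       (λ ε≤-xn → -x≯0 (entry-positive (-ᵣ x) 0<ε k (ℕ.m⊔n≤o⇒n≤o N M p) ε≤-xn))
  where
  bound : ∀ p → ¬ (ε ℚ.≤ p) → ¬ (ε ℚ.≤ ℚ.- p) → ℚ.∣ p ℚ.- 0ℚ ∣ ℚ.≤ ε
  bound p ε≰p ε≰-p rewrite ℚ.+-identityʳ p with ℚ.∣p∣≡p∨∣p∣≡-p p
  ... | inj₁ eq = subst (ℚ._≤ ε) (sym eq) (ℚ.<⇒≤ (ℚ.≰⇒> ε≰p))
  ... | inj₂ eq = subst (ℚ._≤ ε) (sym eq) (ℚ.<⇒≤ (ℚ.≰⇒> ε≰-p))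

∣i∣≤‖‖ : ∀ {n} (ν : ℝ^ n) i m → ℚ.∣ seq (ν i) m ∣ ℚ.≤ seq ‖ ν ‖ m
0≤‖‖ : ∀ {n} (ν : ℝ^ n) m → 0ℚ ℚ.≤ seq ‖ ν ‖ m

0≤‖‖ {zero}  ν m = ℚ.≤-refl
0≤‖‖ {suc n} ν m = ℚ.+-mono-≤ (ℚ.0≤∣p∣ (seq (ν zero) m)) (0≤‖‖ (ν ∘ suc) m)

∣i∣≤‖‖ {suc n} ν zero    m = subst (ℚ._≤ seq ‖ ν ‖ m) (ℚ.+-identityʳ _)
  (ℚ.+-monoʳ-≤ ℚ.∣ seq (ν zero) m ∣ (0≤‖‖ (ν ∘ suc) m))
∣i∣≤‖‖ {suc n} ν (suc i) m = ℚ.≤-trans (∣i∣≤‖‖ (ν ∘ suc) i m)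
  (subst (ℚ._≤ seq ‖ ν ‖ m) (ℚ.+-identityˡ _)
    (ℚ.+-monoˡ-≤ (seq ‖ ν ∘ suc ‖ m) (ℚ.0≤∣p∣ (seq (ν zero) m))))

‖‖≡0 : ∀ {n} (ν : ℝ^ n) m → (∀ i → seq (ν i) m ≡ 0ℚ) → seq ‖ ν ‖ m ≡ 0ℚ
‖‖≡0 {zero}  ν m h = refl
‖‖≡0 {suc n} ν m h =
  trans (cong (λ p → ℚ.∣ p ∣ ℚ.+ seq ‖ ν ∘ suc ‖ m) (h zero))
    (trans (ℚ.+-identityˡ _) (‖‖≡0 (ν ∘ suc) m (h ∘ suc)))

fromℚ-positive : ∀ {p} → 0ℚ ℚ.< p → 0ᵣ <ᵣ fromℚ p
fromℚ-positive {p} 0<p = p , 0<p , 0 , λ _ _ → ℚ.≤-reflexive (ℚ.+-identityˡ p)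

-- As `_≤ᵣ_` is a negation, one index beyond the start of the alleged gap is enough to refute it.
≤ᵣ-intro : ∀ x y → (∀ N → ∃[ n ] N ℕ.≤ n × seq x n ℚ.≤ seq y n) → x ≤ᵣ y
≤ᵣ-intro x y h (ε , 0<ε , N , y+ε≤x) =
  let (n , N≤n , x≤y) = h N
  in ℚ.<-irrefl refl (ℚ.<-≤-trans
       (subst (ℚ._< seq y n ℚ.+ ε) (ℚ.+-identityʳ (seq y n)) (ℚ.+-monoʳ-< (seq y n) 0<ε))
       (ℚ.≤-trans (y+ε≤x n N≤n) x≤y))

drop-0+ : ∀ p {q} → 0ℚ ℚ.+ p ℚ.≤ q → p ℚ.≤ q
drop-0+ p {q} = subst (ℚ._≤ q) (ℚ.+-identityˡ p)

0≤0 : 0ᵣ ≤ᵣ 0ᵣ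
0≤0 = ≤ᵣ-intro 0ᵣ 0ᵣ λ N → N , ℕ.≤-refl , ℚ.≤-refl

≥0∧≤0⇒≈0 : ∀ x → 0ᵣ ≤ᵣ x → x ≤ᵣ 0ᵣ → x ≈ᵣ 0ᵣ
≥0∧≤0⇒≈0 x 0≤x x≤0 = ≈0-intro x x≤0 λ (ε , 0<ε , N , h) → 0≤x (ε , 0<ε , N , λ n N≤n →
  subst₂ ℚ._≤_
    (solve 2 (λ e a → (con 0ℚ :+ e) :+ a := a :+ e) refl ε (seq x n))
    (ℚ.+-inverseˡ (seq x n))
    (ℚ.+-monoˡ-≤ (seq x n) (h n N≤n)))

-- Flows of slope 1.

module UnitFlow {n} (f : ℝ^ n → ℝ^ n) (f≡1 : ∀ ν i m → seq (f ν i) m ≡ 1ℚ) where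

  lipschitz : Lipschitz f
  lipschitz = 0ᵣ , λ ν μ → ≤ᵣ-intro ‖ f ν -ᵥ f μ ‖ (0ᵣ *ᵣ ‖ ν -ᵥ μ ‖) λ N → N , ℕ.≤-refl ,
    ℚ.≤-reflexive (trans
      (‖‖≡0 (f ν -ᵥ f μ) N λ i → cong₂ ℚ._-_ (f≡1 ν i N) (f≡1 μ i N))
      (sym (ℚ.*-zeroˡ (seq ‖ ν -ᵥ μ ‖ N))))

  flow : ℝ^ n → ℝ → ℝ^ n
  flow ν τ i = ν i +ᵣ τ

  flow-≈0 : ∀ ν τ → τ ≈ᵣ 0ᵣ → flow ν τ ≋ ν
  flow-≈0 ν τ τ≈0 i = ≈ᵣ-trans {ν i +ᵣ τ} {ν i +ᵣ 0ᵣ} {ν i}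
    (+ᵣ-cong {ν i} {ν i} {τ} {0ᵣ} (≈ᵣ-refl {ν i}) τ≈0)
    (≗⇒≈ᵣ {ν i +ᵣ 0ᵣ} {ν i} λ m → ℚ.+-identityʳ (seq (ν i) m))

  flow-solution : ∀ ν → Solution f ν (flow ν)
  flow-solution ν = record
    { start      = flow-≈0 ν 0ᵣ (≈ᵣ-refl {0ᵣ})
    ; derivative = λ t _ ε (η , 0<η , M , η≤ε) →
        -- The error term vanishes identically, so any δ serves. The index is pushed beyond `M`,
        -- from where the entries of `ε` are known to be positive.
        fromℚ 1ℚ , fromℚ-positive (ℚ.positive⁻¹ 1ℚ) , λ s _ _ →
        let u = (flow ν s -ᵥ flow ν t) -ᵥ (s -ᵣ t) *ᵥ f (flow ν t) in
        ≤ᵣ-intro ‖ u ‖ (ε *ᵣ ∣ s -ᵣ t ∣ᵣ) λ N → N ℕ.⊔ M , ℕ.m≤m⊔n N M ,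
        let m = N ℕ.⊔ M
            d = ℚ.∣ seq s m ℚ.- seq t m ∣
            0≤ε = ℚ.≤-trans (ℚ.<⇒≤ 0<η)
                    (drop-0+ η (η≤ε m (ℕ.m≤n⊔m N M)))
        in subst₂ ℚ._≤_
             (trans (ℚ.*-zeroˡ d) (sym (‖‖≡0 u m λ i → trans
               (cong (λ z → (seq (ν i) m ℚ.+ seq s m) ℚ.- (seq (ν i) m ℚ.+ seq t m)
                              ℚ.- (seq s m ℚ.- seq t m) ℚ.* z) (f≡1 (flow ν t) i m))
               (solve 3 (λ a s t → ((a :+ s) :- (a :+ t)) :- (s :- t) :* con 1ℚ := con 0ℚ) refl
                  (seq (ν i) m) (seq s m) (seq t m)))))
             refl
             (ℚ.*-monoʳ-≤-nonNeg d {{ℚ.nonNegative (ℚ.0≤∣p∣ (seq s m ℚ.- seq t m))}} 0≤ε)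
    }

  module _ {ν : ℝ^ n} {x : ℝ → ℝ^ n} (sol : Solution f ν x) (t : ℝ) where
    open Solution sol

    -- If `t` were positive, a component that stays 0 up to time `t` would have slope 0 at time 0
    -- instead of 1.
    constant-component : ∀ i → 0ᵣ ≤ᵣ t → (∀ τ → 0ᵣ ≤ᵣ τ → τ ≤ᵣ t → x τ i ≈ᵣ 0ᵣ) → t ≤ᵣ 0ᵣ
    constant-component i 0≤t x≈0 (η , 0<η , N , η≤t) =
      -- The derivative at 0 is tested with tolerance 1/2 at the time `p`, which is below both `t`
      -- and `δ`.
      let (δ , (ζ , 0<ζ , M , ζ≤δ) , D) = derivative 0ᵣ 0≤0 (fromℚ ½) (fromℚ-positive (ℚ.positive⁻¹ ½))
          p = η ℚ.⊓ ζ
          0<p : 0ℚ ℚ.< p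
          0<p = ⊓-positive 0<η 0<ζ
          s = fromℚ p
          -- With both values of `x` within q/2 of 0, the error is at least p - q, which equals p/2
          -- + q because q = p/4: it exceeds the allowed p/2 by `q`.
          q = ½ ℚ.* (½ ℚ.* p)
          0<q = ½-positive (½-positive 0<p)
          0≤s = ≤ᵣ-intro 0ᵣ s λ K → K , ℕ.≤-refl , ℚ.<⇒≤ 0<p
          s≤t = ≤ᵣ-intro s t λ K → K ℕ.⊔ N , ℕ.m≤m⊔n K N ,
                  ℚ.≤-trans (ℚ.p⊓q≤p η ζ) (drop-0+ η (η≤t _ (ℕ.m≤n⊔m K N)))
          ∣p-0∣≡p = trans (cong ℚ.∣_∣ (ℚ.+-identityʳ p)) (ℚ.0≤p⇒∣p∣≡p (ℚ.<⇒≤ 0<p))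
          ∣s∣≤δ = ≤ᵣ-intro ∣ s -ᵣ 0ᵣ ∣ᵣ δ λ K → K ℕ.⊔ M , ℕ.m≤m⊔n K M ,
                  ℚ.≤-trans (ℚ.≤-trans (ℚ.≤-reflexive ∣p-0∣≡p) (ℚ.p⊓q≤q η ζ))
                    (drop-0+ ζ (ζ≤δ _ (ℕ.m≤n⊔m K M)))
          (N₁ , a≤) = x≈0 s 0≤s s≤t (½ ℚ.* q) (½-positive 0<q)
          (N₂ , b≤) = x≈0 0ᵣ 0≤0 0≤t (½ ℚ.* q) (½-positive 0<q)
          u = (x s -ᵥ x 0ᵣ) -ᵥ (s -ᵣ 0ᵣ) *ᵥ f (x 0ᵣ)
      in D s 0≤s ∣s∣≤δ (q , 0<q , N₁ ℕ.⊔ N₂ , λ m N≤m →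
           ℚ.≤-trans
             (subst (λ z → ½ ℚ.* z ℚ.+ q ℚ.≤ ℚ.∣ seq (u i) m ∣) (sym ∣p-0∣≡p)
               (estimate p (seq (x s i) m) (seq (x 0ᵣ i) m) (seq (f (x 0ᵣ) i) m) (f≡1 (x 0ᵣ) i m)
                  (a≤ m (ℕ.m⊔n≤o⇒m≤o N₁ N₂ N≤m)) (b≤ m (ℕ.m⊔n≤o⇒n≤o N₁ N₂ N≤m))))
             (∣i∣≤‖‖ u i m))
      where
      ⊓-positive : ∀ {p q} → 0ℚ ℚ.< p → 0ℚ ℚ.< q → 0ℚ ℚ.< p ℚ.⊓ q
      ⊓-positive {p} {q} 0<p 0<q with ℚ.⊓-sel p q
      ... | inj₁ eq = subst (0ℚ ℚ.<_) (sym eq) 0<p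
      ... | inj₂ eq = subst (0ℚ ℚ.<_) (sym eq) 0<q
      estimate : ∀ p a b c → c ≡ 1ℚ →
        ℚ.∣ a ℚ.- 0ℚ ∣ ℚ.≤ ½ ℚ.* (½ ℚ.* (½ ℚ.* p)) → ℚ.∣ b ℚ.- 0ℚ ∣ ℚ.≤ ½ ℚ.* (½ ℚ.* (½ ℚ.* p)) →
        ½ ℚ.* p ℚ.+ ½ ℚ.* (½ ℚ.* p) ℚ.≤ ℚ.∣ (a ℚ.- b) ℚ.- (p ℚ.- 0ℚ) ℚ.* c ∣
      estimate p a b c refl ∣a∣≤e ∣b∣≤e = +-cancelʳ-≤ q (begin
        (½ ℚ.* p ℚ.+ q) ℚ.+ q
          ≡⟨ solve 3 (λ p a b → (con ½ :* p :+ con ½ :* (con ½ :* p)) :+ con ½ :* (con ½ :* p) :=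
               (:- ((a :- b) :- (p :- con 0ℚ) :* con 1ℚ)) :+ ((a :- con 0ℚ) :+ (:- (b :- con 0ℚ))))
               refl p a b ⟩
        ℚ.- u ℚ.+ ((a ℚ.- 0ℚ) ℚ.+ ℚ.- (b ℚ.- 0ℚ))
          ≤⟨ ℚ.+-mono-≤ (neg≤ u ℚ.≤-refl) (ℚ.+-mono-≤ (ℚ.≤-trans (p≤∣p∣ (a ℚ.- 0ℚ)) ∣a∣≤e) (neg≤ (b ℚ.- 0ℚ) ∣b∣≤e)) ⟩
        ℚ.∣ u ∣ ℚ.+ (e ℚ.+ e)
          ≡⟨ cong (ℚ.∣ u ∣ ℚ.+_) (½-double q) ⟩
        ℚ.∣ u ∣ ℚ.+ q ∎)
        where
        open ℚ.≤-Reasoning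
        q = ½ ℚ.* (½ ℚ.* p)
        e = ½ ℚ.* q
        u = (a ℚ.- b) ℚ.- (p ℚ.- 0ℚ) ℚ.* 1ℚ
        neg≤ : ∀ r {z} → ℚ.∣ r ∣ ℚ.≤ z → ℚ.- r ℚ.≤ z
        neg≤ r h = ℚ.≤-trans (p≤∣p∣ (ℚ.- r)) (subst (ℚ._≤ _) (sym (ℚ.∣-p∣≡∣p∣ r)) h)

    -- A solution is a function of representing sequences and need not respect `_≈ᵣ_`. That `x t`
    -- equals `x 0ᵣ` is instead drawn from the derivative at 0, which bounds the error of
    -- linearisation by the absolute value of `t`.
    at-≈0 : t ≈ᵣ 0ᵣ → 0ᵣ ≤ᵣ t → x t ≋ ν
    at-≈0 t≈0 0≤t i =
      -- Here `x t` is split into the error `w`, which is 0, and the linear part, which is `ν`.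
      ≈ᵣ-trans {x t i} {w i +ᵣ (x 0ᵣ i +ᵣ t)} {ν i}
        (≗⇒≈ᵣ {x t i} {w i +ᵣ (x 0ᵣ i +ᵣ t)} λ m → trans
          (solve 3 (λ a b t → a := ((a :- b) :- (t :- con 0ℚ) :* con 1ℚ) :+ (b :+ t)) refl
             (seq (x t i) m) (seq (x 0ᵣ i) m) (seq t m))
          (cong (λ z → ((seq (x t i) m ℚ.- seq (x 0ᵣ i) m) ℚ.- (seq t m ℚ.- 0ℚ) ℚ.* z)
                         ℚ.+ (seq (x 0ᵣ i) m ℚ.+ seq t m)) (sym (f≡1 (x 0ᵣ) i m))))
        (≈ᵣ-trans {w i +ᵣ (x 0ᵣ i +ᵣ t)} {0ᵣ +ᵣ (ν i +ᵣ 0ᵣ)} {ν i}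
          (+ᵣ-cong {w i} {0ᵣ} {x 0ᵣ i +ᵣ t} {ν i +ᵣ 0ᵣ} wᵢ≈0
            (+ᵣ-cong {x 0ᵣ i} {ν i} {t} {0ᵣ} (start i) t≈0))
          (≗⇒≈ᵣ {0ᵣ +ᵣ (ν i +ᵣ 0ᵣ)} {ν i} λ m → trans (ℚ.+-identityˡ _) (ℚ.+-identityʳ _)))
      where
      w : ℝ^ n
      w = (x t -ᵥ x 0ᵣ) -ᵥ (t -ᵣ 0ᵣ) *ᵥ f (x 0ᵣ)

      small : ‖ w ‖ ≤ᵣ fromℚ 1ℚ *ᵣ ∣ t -ᵣ 0ᵣ ∣ᵣ
      small =
        let (δ , (ζ , 0<ζ , M , ζ≤δ) , D) =
              derivative 0ᵣ 0≤0 (fromℚ 1ℚ) (fromℚ-positive (ℚ.positive⁻¹ 1ℚ))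
            (N , h) = t≈0 ζ 0<ζ
        in D t 0≤t (≤ᵣ-intro ∣ t -ᵣ 0ᵣ ∣ᵣ δ λ K → K ℕ.⊔ (N ℕ.⊔ M) , ℕ.m≤m⊔n K (N ℕ.⊔ M) ,
             let le = ℕ.m≤n⊔m K (N ℕ.⊔ M)
             in ℚ.≤-trans (h _ (ℕ.m⊔n≤o⇒m≤o N M le))
                  (drop-0+ ζ (ζ≤δ _ (ℕ.m⊔n≤o⇒n≤o N M le))))

      not-apart : ∀ {ε N} → 0ℚ ℚ.< ε → ¬ (∀ m → N ℕ.≤ m → ε ℚ.≤ ℚ.∣ seq (w i) m ∣)
      not-apart {ε} {N} 0<ε h =
        let (M , k) = t≈0 (½ ℚ.* ε) (½-positive 0<ε)
        in small (½ ℚ.* ε , ½-positive 0<ε , N ℕ.⊔ M , λ m le → begin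
             1ℚ ℚ.* ℚ.∣ seq t m ℚ.- 0ℚ ∣ ℚ.+ ½ ℚ.* ε ≡⟨ cong (ℚ._+ ½ ℚ.* ε) (ℚ.*-identityˡ ℚ.∣ seq t m ℚ.- 0ℚ ∣) ⟩
             ℚ.∣ seq t m ℚ.- 0ℚ ∣ ℚ.+ ½ ℚ.* ε ≤⟨ ℚ.+-monoˡ-≤ (½ ℚ.* ε) (k m (ℕ.m⊔n≤o⇒n≤o N M le)) ⟩
             ½ ℚ.* ε ℚ.+ ½ ℚ.* ε ≡⟨ ½-double ε ⟩
             ε ≤⟨ h m (ℕ.m⊔n≤o⇒m≤o N M le) ⟩
             ℚ.∣ seq (w i) m ∣ ≤⟨ ∣i∣≤‖‖ w i m ⟩
             seq ‖ w ‖ m ∎)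
        where open ℚ.≤-Reasoning

      wᵢ≈0 : w i ≈ᵣ 0ᵣ
      wᵢ≈0 = ≈0-intro (w i)
        (λ (ε , 0<ε , N , h) → not-apart 0<ε λ m le →
          ℚ.≤-trans (drop-0+ ε (h m le)) (p≤∣p∣ (seq (w i) m)))
        (λ (ε , 0<ε , N , h) → not-apart 0<ε λ m le →
          ℚ.≤-trans (drop-0+ ε (h m le))
            (ℚ.≤-trans (p≤∣p∣ (ℚ.- seq (w i) m)) (ℚ.≤-reflexive (ℚ.∣-p∣≡∣p∣ (seq (w i) m)))))

    stationary : ∀ i → 0ᵣ ≤ᵣ t → (∀ τ → 0ᵣ ≤ᵣ τ → τ ≤ᵣ t → x τ i ≈ᵣ 0ᵣ) → x t ≋ ν
    stationary i 0≤t x≈0 = at-≈0 (≥0∧≤0⇒≈0 t 0≤t (constant-component i 0≤t x≈0)) 0≤t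

-- Guards and jumps on valuations by natural numbers.

⋀ : ∀ {m n} → (Fin m → Formula n) → Formula n
⋀ {zero}  f = const 0ℚ ≐ const 0ℚ
⋀ {suc m} f = f zero ∧ᶠ ⋀ (f ∘ suc)

⋀⁺ : ∀ {m n} (f : Fin m → Formula n) {ν} → (∀ i → satisfies (f i) ν) → satisfies (⋀ f) ν
⋀⁺ {zero}  f h = ≈ᵣ-refl {0ᵣ}
⋀⁺ {suc m} f h = h zero , ⋀⁺ (f ∘ suc) (h ∘ suc)

⋀⁻ : ∀ {m n} (f : Fin m → Formula n) {ν} → satisfies (⋀ f) ν → ∀ i → satisfies (f i) ν
⋀⁻ f (h , _) zero    = h
⋀⁻ f (_ , h) (suc i) = ⋀⁻ (f ∘ suc) h i

weaken : ∀ {n} m → Term n → Term (n ℕ.+ m)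
weaken m (var i)   = var (i ↑ˡ m)
weaken m (const q) = const q
weaken m (s ⊕ t)   = weaken m s ⊕ weaken m t
weaken m (s ⊗ t)   = weaken m s ⊗ weaken m t
weaken m (⊖ t)     = ⊖ weaken m t

weaken-≗ : ∀ {n m} (t : Term n) (ν : ℝ^ n) (μ : ℝ^ m) k →
  seq (evalTerm (weaken m t) (ν Fun.++ μ)) k ≡ seq (evalTerm t ν) k
weaken-≗ (var i)   ν μ k = cong (λ x → seq x k) (Fun.lookup-++ˡ ν μ i)
weaken-≗ (const q) ν μ k = refl
weaken-≗ (s ⊕ t)   ν μ k = cong₂ ℚ._+_ (weaken-≗ s ν μ k) (weaken-≗ t ν μ k)
weaken-≗ (s ⊗ t)   ν μ k = cong₂ ℚ._*_ (weaken-≗ s ν μ k) (weaken-≗ t ν μ k)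
weaken-≗ (⊖ t)     ν μ k = cong ℚ.-_ (weaken-≗ t ν μ k)

-- The jump of a simultaneous assignment; the primed copy of variable `i` has index `n ↑ʳ i`.
update : ∀ {n} → (Fin n → Term n) → Formula (n ℕ.+ n)
update {n} ts = ⋀ λ i → var (n ↑ʳ i) ≐ weaken n (ts i)

++-≋ : ∀ {n m} {ν ν′ : ℝ^ n} {μ : ℝ^ m} → ν ≋ ν′ → ν Fun.++ μ ≋ ν′ Fun.++ μ
++-≋ {n} {μ = μ} ν≋ν′ i with splitAt n i
... | inj₁ j = ν≋ν′ j
... | inj₂ j = ≈ᵣ-refl {μ j}

≋-sym : ∀ {n} (ν μ : ℝ^ n) → ν ≋ μ → μ ≋ ν
≋-sym ν μ h i = ≈ᵣ-sym {ν i} {μ i} (h i)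

⟪_⟫ : ∀ {n} → (Fin n → ℕ) → ℝ^ n
⟪ q ⟫ = fromℚ ∘ fromℕ ∘ q

-- The valuations of an arbitrary run are natural only up to `_≋_`, whereas `ts≗` computes at the
-- representatives `⟪ q ⟫`; `evalTerm-cong` connects the two.
module _ {n} (ts : Fin n → Term n) {ν : ℝ^ n} {q q′ : Fin n → ℕ} (ν≋ : ν ≋ ⟪ q ⟫)
  (ts≗ : ∀ i → evalTerm (ts i) ⟪ q ⟫ ≗ℕ q′ i) where

  private
    ts≈ : ∀ (μ : ℝ^ n) i → evalTerm (weaken n (ts i)) (ν Fun.++ μ) ≈ᵣ ⟪ q′ ⟫ i
    ts≈ μ i =
      let w = evalTerm (weaken n (ts i)) (ν Fun.++ μ)
          u = evalTerm (ts i) ν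
          v = evalTerm (ts i) ⟪ q ⟫
      in ≈ᵣ-trans {w} {u} {⟪ q′ ⟫ i} (≗⇒≈ᵣ {w} {u} (weaken-≗ (ts i) ν μ))
           (≈ᵣ-trans {u} {v} {⟪ q′ ⟫ i} (evalTerm-cong (ts i) ν≋) (≗⇒≈ᵣ {v} {⟪ q′ ⟫ i} (ts≗ i)))

    primed : ∀ (μ : ℝ^ n) i → (ν Fun.++ μ) (n ↑ʳ i) ≈ᵣ μ i
    primed μ i = subst (_≈ᵣ μ i) (sym (Fun.lookup-++ʳ ν μ i)) (≈ᵣ-refl {μ i})

  update⁺ : ∀ {μ} → μ ≋ ⟪ q′ ⟫ → satisfies (update ts) (ν Fun.++ μ)
  update⁺ {μ} μ≋ = ⋀⁺ _ λ i →
    let w  = evalTerm (weaken n (ts i)) (ν Fun.++ μ)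
        μ′ = (ν Fun.++ μ) (n ↑ʳ i)
    in ≈ᵣ-trans {μ′} {μ i} {w} (primed μ i)
         (≈ᵣ-trans {μ i} {⟪ q′ ⟫ i} {w} (μ≋ i) (≈ᵣ-sym {w} {⟪ q′ ⟫ i} (ts≈ μ i)))

  update⁻ : ∀ {μ} → satisfies (update ts) (ν Fun.++ μ) → μ ≋ ⟪ q′ ⟫
  update⁻ {μ} h i =
    let w  = evalTerm (weaken n (ts i)) (ν Fun.++ μ)
        μ′ = (ν Fun.++ μ) (n ↑ʳ i)
    in ≈ᵣ-trans {μ i} {μ′} {⟪ q′ ⟫ i} (≈ᵣ-sym {μ′} {μ i} (primed μ i))
         (≈ᵣ-trans {μ′} {w} {⟪ q′ ⟫ i} (⋀⁻ _ h i) (ts≈ μ i))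

module _ {n} (t : Term n) {ν : ℝ^ n} {q : Fin n → ℕ} {m} (ν≋ : ν ≋ ⟪ q ⟫)
  (t≗ : evalTerm t ⟪ q ⟫ ≗ℕ m) where

  private
    t≈ : evalTerm t ν ≈ᵣ fromℚ (fromℕ m)
    t≈ = let u = evalTerm t ν
             v = evalTerm t ⟪ q ⟫
         in ≈ᵣ-trans {u} {v} {fromℚ (fromℕ m)} (evalTerm-cong t ν≋) (≗⇒≈ᵣ {v} {fromℚ (fromℕ m)} t≗)

  guard⁺ : ∀ i → q i ≡ m → satisfies (var i ≐ t) ν
  guard⁺ i refl = ≈ᵣ-trans {ν i} {⟪ q ⟫ i} {evalTerm t ν} (ν≋ i)
    (≈ᵣ-sym {evalTerm t ν} {⟪ q ⟫ i} t≈)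

  guard⁻ : ∀ i → satisfies (var i ≐ t) ν → q i ≡ m
  guard⁻ i h = fromℕ-injective
    (≈ᵣ-trans {⟪ q ⟫ i} {ν i} {fromℚ (fromℕ m)} (≈ᵣ-sym {ν i} {⟪ q ⟫ i} (ν≋ i))
      (≈ᵣ-trans {ν i} {evalTerm t ν} {fromℚ (fromℕ m)} h t≈))

-- Guessing by counting, and infinite sequences ending in a loop.

infix 4 _↑_

data _↑_ {k} : Vec ℕ k → Vec ℕ k → Set where
  incremented : ∀ w i → w ↑ Vec.updateAt w i suc

-- This lets a run guess arbitrary values of the metavariables before a rule is applied.
counting : ∀ {k} (w : Vec ℕ k) → Star _↑_ (Vec.replicate k 0) w
counting []      = done
counting (x ∷ w) = gmap (0 ∷_) (λ { (incremented v i) → incremented (0 ∷ v) (suc i) }) (counting w)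
                   ◅◅ count x
  where
  count : ∀ x → Star _↑_ (0 ∷ w) (x ∷ w)
  count zero    = done
  count (suc x) = count x ◅◅ incremented (x ∷ w) zero ◅ done

codes-surjective : ∀ {k} (w : Vec ℕ k) → ∃[ σ ] Vec.map code σ ≡ w
codes-surjective []      = [] , refl
codes-surjective (x ∷ w) =
  let (D , p) = code-surjective x
      (σ , q) = codes-surjective w
  in D ∷ σ , cong₂ _∷_ p q

incrementAt-≗ : ∀ {k n} (ν : ℝ^ n) (f : Fin k → Term n) (w : Vec ℕ k) →
  (∀ j → evalTerm (f j) ν ≗ℕ Vec.lookup w j) →
  ∀ i j → evalTerm (Fun.updateAt f i (const 1ℚ ⊕_) j) ν ≗ℕ Vec.lookup (Vec.updateAt w i suc) j
incrementAt-≗ ν f (x ∷ w) h zero    zero    m = trans (cong (1ℚ ℚ.+_) (h zero m)) (sym (fromℕ-suc x))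
incrementAt-≗ ν f (x ∷ w) h zero    (suc j) m = h (suc j) m
incrementAt-≗ ν f (x ∷ w) h (suc i) zero    m = h zero m
incrementAt-≗ ν f (x ∷ w) h (suc i) (suc j) m = incrementAt-≗ ν (f ∘ suc) w (h ∘ suc) i j m

-- Traces belong to infinite runs only, so a finite path to acceptance is prolonged by idling at its
-- end.
lasso : ∀ {a ℓ} {A : Set a} {R : A → A → Set ℓ} {x y} → Star R x y → R y y →
  ∃[ f ] f 0 ≡ x × (∀ i → R (f i) (f (suc i))) × (∃[ j ] f j ≡ y)
lasso {y = y} done yRy = (λ _ → y) , refl , (λ _ → yRy) , 0 , refl
lasso {A = A} {R} {x} (xRz ◅ path) yRy =
  let (f , f0≡z , fR , j , fj≡y) = lasso path yRy
      g : ℕ → A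
      g = λ { zero → x ; (suc i) → f i }
  in g , refl , (λ { zero → subst (R x) (sym f0≡z) xRz ; (suc i) → fR i }) , suc j , fj≡y

-- Automata in which no time passes.

Enabled : ∀ {m a n} → TransitionSyntax m a n → ℝ^ n → ℝ^ n → Set
Enabled τ ν ν′ = satisfies guard ν × satisfies jump (ν Fun.++ ν′)
  where open TransitionSyntax τ

-- The syntax of a semantic transition is recovered from the list; guard and jump are moved from the
-- valuation `μ` after the delay to `ν` before it.
enabled : ∀ {m a n} (Δ : List (TransitionSyntax m a n)) {p g b j p′ μ ν ν′} →
  transition p g b j p′ ∈ˡ List.map ⟦_⟧ᵗ Δ → μ ≋ ν → μ ∈⟦ g ⟧ → (μ Fun.++ ν′) ∈⟦ j ⟧ →
  ∃[ τ ] τ ∈ˡ Δ × TransitionSyntax.source τ ≡ p × TransitionSyntax.target τ ≡ p′ × Enabled τ ν ν′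
enabled Δ τ∈ μ≋ν μ⊨g μν′⊨j with ∈-map⁻ ⟦_⟧ᵗ {xs = Δ} τ∈
... | τ@(transitionSyntax _ g _ j _) , τ∈Δ , refl =
  τ , τ∈Δ , refl , refl , satisfies-resp g μ≋ν μ⊨g , satisfies-resp j (++-≋ μ≋ν) μν′⊨j

HasUnitFlow : Presentation → Set
HasUnitFlow S = ∀ m i → Vec.lookup (Vec.lookup F m) i ≡ const 1ℚ
  where open Presentation S

slope-1 : ∀ S → HasUnitFlow S → ∀ m ν i j →
  seq (⟦ Vec.lookup (Presentation.F S) m ⟧ᵛ ν i) j ≡ 1ℚ
slope-1 S unit m ν i j = cong (λ t → seq (evalTerm t ν) j) (unit m i)

unitFlow-wellFormed : ∀ S → HasUnitFlow S → WellFormed S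
unitFlow-wellFormed S unit m =
  UnitFlow.lipschitz ⟦ Vec.lookup (Presentation.F S) m ⟧ᵛ (slope-1 S unit m)

-- If every flow has slope 1, then the invariant that some variable, the clock, is 0 rules out
-- any passage of time: such an automaton is a discrete transition system.
module Clocked (S : Presentation) (wf : WellFormed S) (unit : HasUnitFlow S)
  (clock : Fin (Presentation.vars S))
  (I≡ : ∀ m → Vec.lookup (Presentation.I S) m ≡ (var clock ≐ const 0ℚ)) where

  open Presentation S using (Δ)
  open HybridKripkeStructure ⟦ S , wf ⟧ using (automaton; F; I)
  open Configuration

  clock≈0 : ∀ m ν → ν ∈⟦ I m ⟧ → ν clock ≈ᵣ 0ᵣ
  clock≈0 m ν = subst (λ f → satisfies f ν) (I≡ m)

  invariant⁺ : ∀ m ν → ν clock ≈ᵣ 0ᵣ → ν ∈⟦ I m ⟧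
  invariant⁺ m ν = subst (λ f → satisfies f ν) (sym (I≡ m))

  no-time : ∀ {m ν x t} → Solution (F m) ν x → 0ᵣ ≤ᵣ t →
    (∀ τ → 0ᵣ ≤ᵣ τ → τ ≤ᵣ t → x τ ∈⟦ I m ⟧) → x t ≋ ν
  no-time {m} {x = x} {t} sol 0≤t x⊨I = UnitFlow.stationary (F m) (slope-1 S unit m) sol t clock 0≤t
    λ τ 0≤τ τ≤t → clock≈0 m (x τ) (x⊨I τ 0≤τ τ≤t)

  step⁻ : ∀ {c t a c′} → Step automaton c t a c′ →
    ∃[ τ ] τ ∈ˡ Δ × TransitionSyntax.source τ ≡ mode c × TransitionSyntax.target τ ≡ mode c′ ×
      Enabled τ (valuation c) (valuation c′)
  step⁻ {c} {t} {a} {c′} (0≤t , g , j , τ∈ , x , sol , x⊨g , x⊨I , x⊨j) =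
    enabled Δ {g = g} {j = j} {μ = x t} {ν = valuation c} {ν′ = valuation c′} τ∈
      (no-time {mode c} {valuation c} {x} {t} sol 0≤t x⊨I) x⊨g x⊨j

  step⁺ : ∀ {τ} c c′ → τ ∈ˡ Δ → TransitionSyntax.source τ ≡ mode c →
    TransitionSyntax.target τ ≡ mode c′ → Enabled τ (valuation c) (valuation c′) →
    Step automaton c 0ᵣ (TransitionSyntax.action τ) c′
  step⁺ {transitionSyntax m g a j m′} (configuration _ ν inv) (configuration _ ν′ inv′)
    τ∈ refl refl (ν⊨g , νν′⊨j) =
    0≤0 , ⟦ g ⟧ᶠ , ⟦ j ⟧ᶠ , ∈-map⁺ ⟦_⟧ᵗ τ∈ , flow ν , flow-solution ν ,
    satisfies-resp g ν≋ ν⊨g ,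
    -- A time between 0 and 0 is only `_≈ᵣ_` to `0ᵣ`, so the invariant has to be transported.
    (λ τ 0≤τ τ≤0 → resp (I m) (≋-sym (flow ν τ) ν (flow-≈0 ν τ (≥0∧≤0⇒≈0 τ 0≤τ τ≤0))) inv) ,
    satisfies-resp j (++-≋ ν≋) νν′⊨j
    where
    open UnitFlow (F m) (slope-1 S unit m)
    ν≋ : ν ≋ flow ν 0ᵣ
    ν≋ = ≋-sym (flow ν 0ᵣ) ν (flow-≈0 ν 0ᵣ (≈ᵣ-refl {0ᵣ}))

-- WHILE programs that write polynomial terms.

quoteData : Data → Expr
quoteData nil     = nil′
quoteData (a ∙ b) = cons (quoteData a) (quoteData b)

eval-quote : ∀ D x → evalExpr (quoteData D) x ≡ D
eval-quote nil     x = refl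
eval-quote (a ∙ b) x = cong₂ _∙_ (eval-quote a x) (eval-quote b x)

-- The tags 2 and 3 are those of `_⊕_` and `_⊗_`. Constants have the same encoding for any number of
-- variables, so the instance 0 serves.
consTermExpr : Expr → Expr → Expr
consTermExpr e f =
  node 2 one (node 2 (node 3 half (node 3 (node 2 e f) (node 2 one (node 2 e f)))) f)
  where
  node : ℕ → Expr → Expr → Expr
  node m e f = cons (quoteData (encℕ m)) (cons e f)
  one half : Expr
  one  = quoteData (encTerm (const {0} 1ℚ))
  half = quoteData (encTerm (const {0} ½))

-- The code of the numeral `encℕ m` is left for the term to evaluate, so that a program only nests
-- terms and never computes codes.
unaryTerm : ∀ {n} → ℕ → Term n
unaryTerm zero    = const 0ℚ
unaryTerm (suc m) = consTerm (const 0ℚ) (unaryTerm m)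

unaryTerm-≗ : ∀ {n} m (ν : ℝ^ n) → evalTerm (unaryTerm m) ν ≗ℕ code (encℕ m)
unaryTerm-≗ zero    ν = λ _ → refl
unaryTerm-≗ (suc m) ν =
  consTerm-≗ (const 0ℚ) (unaryTerm m) ν 0 (code (encℕ m)) (λ _ → refl) (unaryTerm-≗ m ν)

-- The number `m` enters twice, as the code of the simulated program and as its input.
initialTerm : ∀ {n} → ℕ → Term n
initialTerm m =
  consTerm (consTerm (const (fromℕ m)) (const 0ℚ)) (consTerm (const 0ℚ) (unaryTerm m))

initialTerm-≗ : ∀ {n} p {m} → m ≡ code p → (ν : ℝ^ n) →
  evalTerm (initialTerm m) ν ≗ℕ code (initialState p (encℕ m))
initialTerm-≗ p {m} refl ν =
  consTerm-≗ (consTerm (const (fromℕ m)) (const 0ℚ)) (consTerm (const 0ℚ) (unaryTerm m)) ν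
    (code (p ∙ nil)) (code (nil ∙ encℕ m))
    (consTerm-≗ (const (fromℕ m)) (const 0ℚ) ν (code p) 0 (λ _ → refl) (λ _ → refl))
    (consTerm-≗ (const 0ℚ) (unaryTerm m) ν 0 (code (encℕ m)) (λ _ → refl) (unaryTerm-≗ m ν))

zeroExpr : Expr
zeroExpr = quoteData (encTerm (const {0} 0ℚ))

-- The variable holds a counter, a copy of the input and the term built so far.
unaryBody : Expr
unaryBody = cons (tl (hd X)) (cons (hd (tl X)) (consTermExpr zeroExpr (tl (tl X))))

unaryLoop : Program
unaryLoop = while (hd X) (X≔ unaryBody)

run-unaryLoop : ∀ {n} i j d → run unaryLoop ∶ encℕ i ∙ d ∙ encTerm (unaryTerm {n} j)
                                ⇓ (nil ∙ d ∙ encTerm (unaryTerm {n} (i ℕ.+ j)))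
run-unaryLoop zero    j d = exit refl
run-unaryLoop {n} (suc i) j d = loop refl assign
  (subst (λ m → run unaryLoop ∶ encℕ i ∙ d ∙ encTerm (unaryTerm {n} (suc j)) ⇓ (nil ∙ d ∙ encTerm (unaryTerm {n} m))) (ℕ.+-suc i j)
    (run-unaryLoop {n} i (suc j) d))

initialTermExpr : Expr
initialTermExpr = consTermExpr (consTermExpr constant zeroExpr) (consTermExpr zeroExpr (tl (tl X)))
  where
  constant : Expr
  -- The encoding of `const (fromℕ m)`: tag 1, the nonnegative numerator `m`, the denominator 1.
  constant = cons (quoteData (encℕ 1)) (cons (cons nil′ (hd (tl X))) (quoteData (encℕ 1)))

eval-initialTerm : ∀ {n} m →
  evalExpr initialTermExpr (nil ∙ encℕ m ∙ encTerm (unaryTerm {n} m)) ≡ encTerm (initialTerm {n} m)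
eval-initialTerm m = refl

-- The automaton of a rewriting system.

-- Variable 1 holds the code of the current tree.  The values of the metavariables of a rule
-- are guessed by counting the registers up from 0, so that these only ever hold naturals.
module Simulation {k} (rules : List (Pattern k × Pattern k)) (final : Data) where

  pattern running = 0F
  pattern halted  = 1F

  register zeros : Fin k → Term (2 ℕ.+ k)
  register i = var (suc (suc i))
  zeros _    = const 0ℚ

  values : Term (2 ℕ.+ k) → (Fin k → Term (2 ℕ.+ k)) → Fin (2 ℕ.+ k) → Term (2 ℕ.+ k)
  values s w = const 0ℚ Fun.∷ s Fun.∷ w

  always : Formula (2 ℕ.+ k)
  always = const 0ℚ ≐ const 0ℚ

  increment : Fin k → TransitionSyntax 2 1 (2 ℕ.+ k)
  increment i = transitionSyntax running always 0F
    (update (values (var 1F) (Fun.updateAt register i (const 1ℚ ⊕_)))) running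

  -- The guard checks the guessed substitution; resetting the registers lets the next guess start
  -- from 0.
  applyRule : Pattern k × Pattern k → TransitionSyntax 2 1 (2 ℕ.+ k)
  applyRule (l , r) = transitionSyntax running (var 1F ≐ patternTerm register l) 0F
    (update (values (patternTerm register r) zeros)) running

  accept idle : TransitionSyntax 2 1 (2 ℕ.+ k)
  accept = transitionSyntax running (var 1F ≐ patternTerm register (closed final)) 0F
    (update (values (const 0ℚ) zeros)) halted
  idle   = transitionSyntax halted always 0F (update (values (const 0ℚ) zeros)) halted

  transitions : List (TransitionSyntax 2 1 (2 ℕ.+ k))
  transitions = accept ∷ idle ∷ List.map increment (allFin k) ++ List.map applyRule rules

  initially : Term (2 ℕ.+ k) → Formula (2 ℕ.+ k)
  initially s = ⋀ λ i → var i ≐ values s zeros i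

  labels : Vec (Subset 1) 2
  labels = (outside ∷ []) ∷ (inside ∷ []) ∷ []

  presentation : Term (2 ℕ.+ k) → Presentation
  presentation s = record
    { modes   = 2
    ; actions = 1
    ; vars    = 2 ℕ.+ k
    ; atoms   = 1
    ; M₀      = ⁅ running ⁆
    ; Δ       = transitions
    ; I       = Vec.replicate 2 (var 0F ≐ const 0ℚ)
    ; F       = Vec.replicate 2 (Vec.replicate (2 ℕ.+ k) (const 1ℚ))
    ; V₀      = initially s
    ; L       = labels
    }

  unitFlow : ∀ s → HasUnitFlow (presentation s)
  unitFlow s m i = trans
    (cong (λ ts → Vec.lookup ts i) (Vec.lookup-replicate m (Vec.replicate (2 ℕ.+ k) (const 1ℚ))))
    (Vec.lookup-replicate i (const 1ℚ))

  wellFormed : ∀ s → WellFormed (presentation s)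
  wellFormed s = unitFlow-wellFormed (presentation s) (unitFlow s)

  neverHalted : LTL 1
  neverHalted = □ (¬′ atom 0F)

  state : ℕ → Vec ℕ k → Fin (2 ℕ.+ k) → ℕ
  state m w = 0 Fun.∷ m Fun.∷ Vec.lookup w

  0s : Vec ℕ k
  0s = Vec.replicate k 0

  values-≗ : ∀ {m} w (ν : ℝ^ (2 ℕ.+ k)) (s : Term (2 ℕ.+ k)) (ws : Fin k → Term (2 ℕ.+ k)) →
    evalTerm s ν ≗ℕ m → (∀ i → evalTerm (ws i) ν ≗ℕ Vec.lookup w i) →
    ∀ i → evalTerm (values s ws i) ν ≗ℕ state m w i
  values-≗ w ν s ws s≗ ws≗ zero          = λ _ → refl
  values-≗ w ν s ws s≗ ws≗ (suc zero)    = s≗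
  values-≗ w ν s ws s≗ ws≗ (suc (suc i)) = ws≗ i

  zeros-≗ : ∀ (ν : ℝ^ (2 ℕ.+ k)) i → evalTerm (zeros i) ν ≗ℕ Vec.lookup 0s i
  zeros-≗ ν i m = cong fromℕ (sym (Vec.lookup-replicate i 0))

  register-≗ : ∀ n (σ : Vec Data k) p →
    evalTerm (patternTerm register p) ⟪ state n (Vec.map code σ) ⟫ ≗ℕ code (instantiate (Vec.lookup σ) p)
  register-≗ n σ = patternTerm-≗ register (Vec.lookup σ) ⟪ state n (Vec.map code σ) ⟫
    λ i _ → cong fromℕ (Vec.lookup-map i code σ)

  instantiate-closed : ∀ (σ : Fin k → Data) D → instantiate σ (closed D) ≡ D
  instantiate-closed σ nil     = refl
  instantiate-closed σ (a ∙ b) = cong₂ _∙_ (instantiate-closed σ a) (instantiate-closed σ b)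

  final-≗ : ∀ n w → evalTerm (patternTerm register (closed final)) ⟪ state n w ⟫ ≗ℕ code final
  final-≗ n w =
    let (σ , map≡w) = codes-surjective w
    in subst (λ w → evalTerm (patternTerm register (closed final)) ⟪ state n w ⟫ ≗ℕ code final) map≡w
         (subst (λ D → evalTerm (patternTerm register (closed final)) ⟪ state n (Vec.map code σ) ⟫ ≗ℕ code D)
           (instantiate-closed (Vec.lookup σ) final) (register-≗ n σ (closed final)))

  increment-values : ∀ {n w} i j →
    evalTerm (values (var 1F) (Fun.updateAt register i (const 1ℚ ⊕_)) j) ⟪ state n w ⟫
      ≗ℕ state n (Vec.updateAt w i suc) j
  increment-values {n} {w} i = values-≗ (Vec.updateAt w i suc) ⟪ state n w ⟫ (var 1F) _ (λ _ → refl)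
    (incrementAt-≗ ⟪ state n w ⟫ register w (λ _ _ → refl) i)

  applyRule-values : ∀ {n} (σ : Vec Data k) r j →
    evalTerm (values (patternTerm register r) zeros j) ⟪ state n (Vec.map code σ) ⟫
      ≗ℕ state (code (instantiate (Vec.lookup σ) r)) 0s j
  applyRule-values {n} σ r = values-≗ 0s ⟪ state n (Vec.map code σ) ⟫ (patternTerm register r) zeros
    (register-≗ n σ r) (zeros-≗ ⟪ state n (Vec.map code σ) ⟫)

  zero-values : ∀ {n w} j → evalTerm (values (const 0ℚ) zeros j) ⟪ state n w ⟫ ≗ℕ state 0 0s j
  zero-values {n} {w} = values-≗ 0s ⟪ state n w ⟫ (const 0ℚ) zeros (λ _ → refl) (zeros-≗ ⟪ state n w ⟫)

  -- Runs when the final tree is unreachable.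

  private
    _⇒*_ : Data → Data → Set
    _⇒*_ = Star (rules ⊢_⟶_)

  -- The invariant of such runs. It carries unreachability of `final` forward and so does not
  -- mention the initial tree.
  data Safe (p : Fin 2) (ν : ℝ^ (2 ℕ.+ k)) : Set where
    safe : ∀ D w → p ≡ running → ν ≋ ⟪ state (code D) w ⟫ → ¬ (D ⇒* final) → Safe p ν

  -- The registers hold the codes of some substitution, and the guard with injectivity of `code`
  -- identifies `D` with the instance of `l`: the jump performs a genuine rewriting step.
  applyRule-safe : ∀ {l r ν ν′} → (l , r) ∈ˡ rules → Safe running ν →
    Enabled (applyRule (l , r)) ν ν′ → Safe running ν′
  applyRule-safe {l} {r} {ν} {ν′} lr∈ (safe D w _ ν≋ D⇏) (ν⊨g , νν′⊨j) =
    let (σ , map≡w) = codes-surjective w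
        q   = state (code D) (Vec.map code σ)
        E   = instantiate (Vec.lookup σ) r
        ν≋′ = subst (λ w → ν ≋ ⟪ state (code D) w ⟫) (sym map≡w) ν≋
        D≡  = code-injective D (instantiate (Vec.lookup σ) l)
                (guard⁻ (patternTerm register l) {ν} {q} ν≋′ (register-≗ (code D) σ l) 1F ν⊨g)
    in safe E 0s refl
         (update⁻ (values (patternTerm register r) zeros) {ν} {q} {state (code E) 0s} ν≋′
           (applyRule-values {code D} σ r) {ν′} νν′⊨j)
         (λ E⇒ → D⇏ (subst (_⇒* final) (sym D≡) (rewriting lr∈ σ ◅ E⇒)))

  enabled-safe : ∀ {τ ν ν′} → τ ∈ˡ transitions → Safe (TransitionSyntax.source τ) ν →
    Enabled τ ν ν′ → Safe (TransitionSyntax.target τ) ν′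
  -- The guard of `accept` would make `D` the final tree itself.
  enabled-safe {ν = ν} (here refl) (safe D w _ ν≋ D⇏) (ν⊨g , _) = ⊥-elim (D⇏ (subst (D ⇒*_)
    (code-injective D final (guard⁻ (patternTerm register (closed final)) {ν} ν≋
      (final-≗ (code D) w) 1F ν⊨g)) done))
  enabled-safe (there (here refl)) (safe _ _ () _ _) _
  enabled-safe {ν = ν} {ν′} (there (there τ∈)) sν en with ∈-++⁻ (List.map increment (allFin k)) τ∈
  ... | inj₂ τ∈rules with ∈-map⁻ applyRule τ∈rules
  ...   | _ , lr∈ , refl = applyRule-safe lr∈ sν en
  enabled-safe {ν = ν} {ν′} (there (there τ∈)) (safe D w _ ν≋ D⇏) (_ , νν′⊨j)
    | inj₁ τ∈incs with ∈-map⁻ increment τ∈incs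
  ...   | i , _ , refl = safe D (Vec.updateAt w i suc) refl
          (update⁻ (values (var 1F) (Fun.updateAt register i (const 1ℚ ⊕_))) {ν} ν≋
            (increment-values {code D} {w} i) νν′⊨j) D⇏

  module _ (s : Term (2 ℕ.+ k)) (D₀ : Data) (s≗ : ∀ ν → evalTerm s ν ≗ℕ code D₀) where

    open Clocked (presentation s) (wellFormed s) (unitFlow s) 0F
      (λ m → Vec.lookup-replicate m (var 0F ≐ const 0ℚ))
    open HybridKripkeStructure ⟦ presentation s , wellFormed s ⟧ using (automaton)
    open Configuration

    initially⁻ : ∀ {ν} → satisfies (initially s) ν → ν ≋ ⟪ state (code D₀) 0s ⟫
    initially⁻ {ν} h i = ≈ᵣ-trans {ν i} {evalTerm (values s zeros i) ν} {⟪ state (code D₀) 0s ⟫ i}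
      (⋀⁻ (λ i → var i ≐ values s zeros i) h i)
      (≗⇒≈ᵣ {evalTerm (values s zeros i) ν} {⟪ state (code D₀) 0s ⟫ i}
        (values-≗ 0s ν s zeros (s≗ ν) (zeros-≗ ν) i))

    run-safe : (ρ : Run automaton) → ¬ (D₀ ⇒* final) → ∀ i →
      Safe (mode (Run.config ρ i)) (valuation (Run.config ρ i))
    run-safe ρ D₀⇏ zero =
      let (m∈ , ν∈) = Run.initial ρ
      in safe D₀ 0s (x∈⁅y⁆⇒x≡y running m∈) (initially⁻ ν∈) D₀⇏
    run-safe ρ D₀⇏ (suc i) =
      let c  = Run.config ρ i
          c′ = Run.config ρ (suc i)
          (τ , τ∈ , src , tgt , en) = step⁻ {c} {Run.delay ρ i} {Run.label ρ i} {c′} (Run.step ρ i)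
      in subst (λ m → Safe m (valuation c′)) tgt
           (enabled-safe τ∈ (subst (λ m → Safe m (valuation c)) (sym src) (run-safe ρ D₀⇏ i)) en)

    not-final⇒neverHalted : ¬ (D₀ ⇒* final) → ⟦ presentation s , wellFormed s ⟧ ⊨ᴷ neverHalted
    not-final⇒neverHalted D₀⇏ σ (ρ , σ≡) i 0∈σ
      with run-safe ρ D₀⇏ (i ℕ.+ 0) | subst (0F ∈_) (σ≡ (i ℕ.+ 0)) 0∈σ
    ... | safe _ _ m≡running _ _ | 0∈L with () ← subst (λ m → 0F ∈ Vec.lookup labels m) m≡running 0∈L

    -- The run that follows a reduction to the final tree.

    at : Fin 2 → ℕ → Vec ℕ k → Configuration automaton
    at m n w = configuration m ⟪ state n w ⟫ (invariant⁺ m ⟪ state n w ⟫ (≈ᵣ-refl {0ᵣ}))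

    _↝_ : Configuration automaton → Configuration automaton → Set₁
    c ↝ c′ = Step automaton c 0ᵣ 0F c′

    ≋-refl : ∀ {n} (ν : ℝ^ n) → ν ≋ ν
    ≋-refl ν i = ≈ᵣ-refl {ν i}

    transit : ∀ {p p′ g n n′ w w′} ts →
      transitionSyntax p g 0F (update ts) p′ ∈ˡ transitions → satisfies g ⟪ state n w ⟫ →
      (∀ i → evalTerm (ts i) ⟪ state n w ⟫ ≗ℕ state n′ w′ i) → at p n w ↝ at p′ n′ w′
    transit {p} {p′} {g} {n} {n′} {w} {w′} ts τ∈ ν⊨g ts≗ =
      step⁺ (at p n w) (at p′ n′ w′) τ∈ refl refl
        (ν⊨g , update⁺ ts {⟪ state n w ⟫} {state n w} {state n′ w′} (≋-refl ⟪ state n w ⟫) ts≗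
                 {⟪ state n′ w′ ⟫} (≋-refl ⟪ state n′ w′ ⟫))

    ↑⇒↝ : ∀ {n v w} → v ↑ w → at running n v ↝ at running n w
    ↑⇒↝ {n} (incremented w i) = transit {w = w} {Vec.updateAt w i suc}
      (values (var 1F) (Fun.updateAt register i (const 1ℚ ⊕_)))
      (there (there (∈-++⁺ˡ (∈-map⁺ increment (∈-allFin i)))))
      (≈ᵣ-refl {0ᵣ}) (increment-values {n} {w} i)

    -- The registers are first counted up to the codes of the substitution; the rule then applies
    -- and resets them.
    ⟶⇒↝ : ∀ {D E} → rules ⊢ D ⟶ E → Star _↝_ (at running (code D) 0s) (at running (code E) 0s)
    ⟶⇒↝ (rewriting {l} {r} lr∈ σ) =
      gmap (at running (code D)) ↑⇒↝ (counting (Vec.map code σ)) ◅◅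
      transit {w = Vec.map code σ} {0s} (values (patternTerm register r) zeros)
        (there (there (∈-++⁺ʳ (List.map increment (allFin k)) (∈-map⁺ applyRule lr∈))))
        (guard⁺ (patternTerm register l) {⟪ q ⟫} {q} (≋-refl ⟪ q ⟫)
          (register-≗ (code D) σ l) 1F refl)
        (applyRule-values {code D} σ r) ◅ done
      where
      D = instantiate (Vec.lookup σ) l
      q = state (code D) (Vec.map code σ)

    ⟶*⇒↝ : ∀ {D E} → D ⇒* E → Star _↝_ (at running (code D) 0s) (at running (code E) 0s)
    ⟶*⇒↝ done     = done
    ⟶*⇒↝ (s ◅ ss) = ⟶⇒↝ s ◅◅ ⟶*⇒↝ ss

    halting : D₀ ⇒* final → Star _↝_ (at running (code D₀) 0s) (at halted 0 0s)
    halting D₀⇒ = ⟶*⇒↝ D₀⇒ ◅◅ transit {w = 0s} {0s} (values (const 0ℚ) zeros) (here refl)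
      (guard⁺ (patternTerm register (closed final)) {⟪ q ⟫} {q} (≋-refl ⟪ q ⟫)
        (final-≗ (code final) 0s) 1F refl)
      (zero-values {code final} {0s}) ◅ done
      where
      q = state (code final) 0s

    halted-idle : at halted 0 0s ↝ at halted 0 0s
    halted-idle = transit {w = 0s} {0s} (values (const 0ℚ) zeros) (there (here refl))
      (≈ᵣ-refl {0ᵣ}) (zero-values {0} {0s})

    initially⁺ : satisfies (initially s) ⟪ state (code D₀) 0s ⟫
    initially⁺ = ⋀⁺ (λ i → var i ≐ values s zeros i) λ i →
      let ν = ⟪ state (code D₀) 0s ⟫
      in ≈ᵣ-sym {evalTerm (values s zeros i) ν} {ν i}
           (≗⇒≈ᵣ {evalTerm (values s zeros i) ν} {ν i} (values-≗ 0s ν s zeros (s≗ ν) (zeros-≗ ν) i))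

    final⇒halted : D₀ ⇒* final → ¬ (⟦ presentation s , wellFormed s ⟧ ⊨ᴷ neverHalted)
    final⇒halted D₀⇒ ⊨never =
      let (f , f0≡ , f↝ , j , fj≡) = lasso (halting D₀⇒) halted-idle
          ρ : Run automaton
          ρ = record
            { config  = f
            ; delay   = λ _ → 0ᵣ
            ; label   = λ _ → 0F
            ; initial = subst (Initial automaton) (sym f0≡) (x∈⁅x⁆ running , initially⁺)
            ; step    = f↝
            }
      in ⊨never (traceOf ⟦ presentation s , wellFormed s ⟧ ρ) (ρ , λ _ → refl) j
           (subst (λ m → 0F ∈ Vec.lookup labels (mode (f m))) (sym (ℕ.+-identityʳ j))
             (subst (λ c → 0F ∈ Vec.lookup labels (mode c)) (sym fj≡) Vec.here))

  -- Computing the presentation from a number.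

  initiallyExpr : Expr → Expr
  initiallyExpr e =
    cons (quoteData (encℕ 2)) (cons (quoteData (encFormula {2 ℕ.+ k} (var 0F ≐ const 0ℚ)))
      (cons (quoteData (encℕ 2)) (cons
        (cons (quoteData (encℕ 0)) (cons (quoteData (encTerm {2 ℕ.+ k} (var 1F))) e))
        (quoteData (encFormula (⋀ λ i → register i ≐ zeros i))))))

  eval-initially : ∀ e x s → evalExpr e x ≡ encTerm s →
    evalExpr (initiallyExpr e) x ≡ encFormula (initially s)
  eval-initially e x s p = cong₂ (λ a b →
      encℕ 2 ∙ encFormula {2 ℕ.+ k} (var 0F ≐ const 0ℚ) ∙ encℕ 2 ∙
        (encℕ 0 ∙ encTerm {2 ℕ.+ k} (var 1F) ∙ a) ∙ b)
    p (eval-quote (encFormula (⋀ λ i → register i ≐ zeros i)) x)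

  private
    module S = Presentation (presentation (const 0ℚ))

  -- Only the initial predicate varies with `s`; the other components are quoted from the instance
  -- `const 0ℚ`.
  presentationExpr : Expr → Expr
  presentationExpr e =
    cons (quoteData (encℕ S.modes)) (cons (quoteData (encℕ S.actions))
    (cons (quoteData (encℕ S.vars)) (cons (quoteData (encℕ S.atoms))
    (cons (quoteData (encSubset S.M₀)) (cons (quoteData (encList encTransition S.Δ))
    (cons (quoteData (encVec encFormula S.I)) (cons (quoteData (encVec (encVec encTerm) S.F))
    (cons (initiallyExpr e) (quoteData (encVec encSubset S.L))))))))))

  eval-presentation : ∀ e x s → evalExpr e x ≡ encTerm s →
    evalExpr (presentationExpr e) x ≡ encPresentation (presentation s)
  eval-presentation e x s p =
    cong₂ _∙_ (eval-quote (encℕ S.modes) x) (cong₂ _∙_ (eval-quote (encℕ S.actions) x)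
    (cong₂ _∙_ (eval-quote (encℕ S.vars) x) (cong₂ _∙_ (eval-quote (encℕ S.atoms) x)
    (cong₂ _∙_ (eval-quote (encSubset S.M₀) x)
    (cong₂ _∙_ (eval-quote (encList encTransition S.Δ) x)
    (cong₂ _∙_ (eval-quote (encVec encFormula S.I) x)
    (cong₂ _∙_ (eval-quote (encVec (encVec encTerm) S.F) x)
    (cong₂ _∙_ (eval-initially e x s p) (eval-quote (encVec encSubset S.L) x)))))))))

  build : Program
  -- One copy of the input is used up as the loop counter, the other survives for the constant in
  -- `initialTerm`.
  build = (X≔ cons X (cons X zeroExpr)) ︔ unaryLoop ︔ (X≔ presentationExpr initialTermExpr)

  run-build : ∀ m → run build ∶ encℕ m ⇓ encPresentation (presentation (initialTerm m))
  run-build m = then assign (then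
    (subst (λ i → run unaryLoop ∶ encℕ m ∙ encℕ m ∙ encTerm (unaryTerm {2 ℕ.+ k} 0)
                                ⇓ (nil ∙ encℕ m ∙ encTerm (unaryTerm {2 ℕ.+ k} i)))
      (ℕ.+-identityʳ m) (run-unaryLoop {2 ℕ.+ k} m 0 (encℕ m)))
    (subst (run (X≔ presentationExpr initialTermExpr) ∶ d ⇓_)
      (eval-presentation initialTermExpr d (initialTerm m) (eval-initialTerm m)) assign))
    where
    d = nil ∙ encℕ m ∙ encTerm (unaryTerm {2 ℕ.+ k} m)

  -- Diagonalisation.

  module _ {ℓ} (R : Representation ℓ) (P : Program) where
    open Representation R

    diagonal : Program
    diagonal = build ︔ translate ︔ (X≔ cons X (quoteData (encLTL neverHalted))) ︔ P

    run-diagonal : ∀ m {c out} → run translate ∶ encPresentation (presentation (initialTerm m)) ⇓ c →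
      run P ∶ (c ∙ encLTL neverHalted) ⇓ out → run diagonal ∶ encℕ m ⇓ out
    run-diagonal m t r = then (run-build m) (then t (then assign r))

    -- Either answer refutes itself: "yes" makes the machine accept, so that the automaton can halt,
    -- and "no" keeps it from accepting, so that the automaton never halts.
    not-decides : ∀ s D₀ (s≗ : ∀ ν → evalTerm s ν ≗ℕ code D₀) →
      (∀ {c out} → run translate ∶ encPresentation (presentation s) ⇓ c →
        run P ∶ (c ∙ encLTL neverHalted) ⇓ out →
        (out ≡ yes → D₀ ⇒* final) × (∀ w → out ≡ no w → ¬ (D₀ ⇒* final))) →
      ¬ Decides R P
    not-decides s D₀ s≗ faithful decides =
      let (c , t , rep)       = translates (presentation s) (wellFormed s)
          (_ , r , ans)       = decides c ⟦ presentation s , wellFormed s ⟧ neverHalted rep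
          (accepts , rejects) = faithful t r
      in refute accepts rejects ans
      where
      refute : ∀ {out} → (out ≡ yes → D₀ ⇒* final) → (∀ w → out ≡ no w → ¬ (D₀ ⇒* final)) →
        ¬ ((out ≡ yes × ⟦ presentation s , wellFormed s ⟧ ⊨ᴷ neverHalted) ⊎
           (∃[ w ] out ≡ no w × ¬ (⟦ presentation s , wellFormed s ⟧ ⊨ᴷ neverHalted)))
      refute accepts _ (inj₁ (out≡ , ⊨never)) = final⇒halted s D₀ s≗ (accepts out≡) ⊨never
      refute _ rejects (inj₂ (w , out≡ , ⊭never)) =
        ⊭never (not-final⇒neverHalted s D₀ s≗ (rejects w out≡))

-- The trace of the violating run witnesses that `K` does not satisfy `φ`.
counterexample⇒decides : ∀ {ℓ ℓ′} (R : Representation ℓ) (describes : RunDescription ℓ′) P →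
  DecidesWithCounterexample R describes P → Decides R P
counterexample⇒decides R describes P decides c K φ rep with decides c K φ rep
... | out , r , inj₁ holds = out , r , inj₁ holds
... | out , r , inj₂ (w , ρ , out≡ , _ , ρ⊭φ) =
  out , r , inj₂ (w , out≡ , λ K⊨φ → ρ⊭φ (K⊨φ (traceOf K ρ) (ρ , λ _ → refl)))

module _ {ℓ} (R : Representation ℓ) (P : Program) where
  open Representation R

  -- Q and m are the diagonal program and its code, kept abstract since the latter is far too
  -- large to be evaluated.
  self-application : ∀ Q m → m ≡ code (compile Q) →
    (∀ {c out} → run translate ∶ encPresentation (Simulation.presentation rules acceptingState (initialTerm m)) ⇓ c →
      run P ∶ (c ∙ encLTL (Simulation.neverHalted rules acceptingState)) ⇓ out → run Q ∶ encℕ m ⇓ out) →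
    ¬ Decides R P
  self-application Q m m≡ run-Q =
    Simulation.not-decides rules acceptingState R P (initialTerm m)
      (initialState (compile Q) (encℕ m)) (initialTerm-≗ (compile Q) m≡)
      λ t r →
        (λ out≡   → run-accepting {Q} {encℕ m} (subst (run Q ∶ encℕ m ⇓_) out≡ (run-Q t r))) ,
        (λ w out≡ → run-rejecting {Q} {encℕ m} {w} (subst (run Q ∶ encℕ m ⇓_) out≡ (run-Q t r)))

  undecidable : ¬ Decides R P
  undecidable = self-application Q (code (compile Q)) refl
    (Simulation.run-diagonal rules acceptingState R P (code (compile Q)))
    where
    Q = Simulation.diagonal rules acceptingState R P

theorem3 : ∀ {ℓ ℓ′} (R : Representation ℓ) →
    (¬ (∃[ P ] Decides R P)) ×
    ((describes : RunDescription ℓ′) → ¬ (∃[ P ] DecidesWithCounterexample R describes P))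
theorem3 R =
  (λ (P , decides) → undecidable R P decides) ,
  λ describes (P , decides) → undecidable R P (counterexample⇒decides R describes P decides)
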